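{- In the size-cost migration model, every randomized online algorithm for non-clairvoyant dynamic bin packing whose expected total migrated size is $o(\text{total size})$ has competitive ratio at least $\frac{\mu}{6}$, where $\mu$ is the ratio of the longest to the shortest item duration.
   Context: Dynamic bin packing: bins have capacity $1$; items arrive online at times $a_i\ge0$ with size $s_i\in[0,1]$ and duration $d_i>0$ (only the size is revealed at arrival), present during $[a_i,a_i+d_i)$. Each item is placed on arrival into an open bin with enough remaining capacity or a new bin; a migration moves an already placed item to another bin. In the size-cost model, migrating item $i$ once costs $s_i$, and the migrated size is the sum of these costs; the total size of an instance is $\sum_i s_i$. Cost = total active time $\int_0^\infty(\text{number of nonempty bins at } t)\,dt$; $\mathrm{OPT}(I)=\int_0^\infty\mathrm{OPT}_t\,dt$ with $\mathrm{OPT}_t$ the minimum number of unit bins to pack the items present at time $t$. Competitive ratio at least $\gamma$: for every $\beta<\gamma$ some instance has expected cost $>\beta\,\mathrm{OPT}$. -}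

module Defs where

open import Algebra.Structures using (IsCommutativeRing)
open import Data.Fin.Base as Fin using (Fin; toℕ)
import Data.Fin.Properties as Fin
open import Data.List.Base using (List; []; _∷_; _++_; map; foldr; filter; length; allFin; deduplicate)
open import Data.List.Relation.Unary.All using (All)
open import Data.List.Relation.Unary.AllPairs using (AllPairs)
import Data.List.Membership.DecPropositional as DecMembership
import Data.List.Sort.InsertionSort.Base as InsertionSort
open import Data.Nat.Base as ℕ using (ℕ; zero; suc)
import Data.Nat.Properties as ℕ
open import Data.Product.Base using (Σ-syntax; ∃-syntax; _×_; _,_)
open import Level using (0ℓ)
open import Relation.Binary.Bundles using (DecTotalOrder)
import Relation.Binary.Construct.On as On
import Relation.Binary.Construct.StrictToNonStrict as StrictToNonStrict
open import Relation.Binary.Core using (Rel)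
open import Relation.Binary.PropositionalEquality using (_≡_; _≢_)
open import Relation.Binary.Structures using (IsStrictTotalOrder)
open import Relation.Nullary.Decidable using (Dec; yes; no; _×-dec_; ¬?)
open import Relation.Unary using (Pred; _∈_; _⊆_; ∁; U; Empty; _∩_; ⋃)

-- Complete ordered fields are unique up to isomorphism, so a statement about
-- all of them is a statement about the (classical) real numbers.
record CompleteOrderedField : Set₁ where
  infix  8 -_ _⁻¹
  infixl 7 _*_ _/_
  infixl 6 _+_ _-_
  infix  4 _<_ _≤_ _<?_ _≤?_
  field
    ℝ       : Set
    _+_ _*_ : ℝ → ℝ → ℝ
    -_      : ℝ → ℝ
    0ℝ 1ℝ   : ℝ
    _⁻¹     : ℝ → ℝ
    _<_     : Rel ℝ 0ℓ

  _≤_ : Rel ℝ 0ℓ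
  _≤_ = StrictToNonStrict._≤_ _≡_ _<_

  -- In the strong form that y < s yields an element above y; classically
  -- this says no more than that s is the least upper bound.
  IsSupremum : Pred ℝ 0ℓ → ℝ → Set
  IsSupremum S s = (∀ x → x ∈ S → x ≤ s) × (∀ y → y < s → ∃[ x ] x ∈ S × y < x)

  field
    isCommutativeRing  : IsCommutativeRing _≡_ _+_ _*_ -_ 0ℝ 1ℝ
    -- 0ℝ ⁻¹ is unspecified.
    *-inverse          : ∀ x → x ≢ 0ℝ → x * x ⁻¹ ≡ 1ℝ
    isStrictTotalOrder : IsStrictTotalOrder _≡_ _<_
    0<1                : 0ℝ < 1ℝ
    +-monoˡ-<          : ∀ x y z → x < y → x + z < y + z
    *-pos              : ∀ x y → 0ℝ < x → 0ℝ < y → 0ℝ < x * y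
    supremum           : (S : Pred ℝ 0ℓ) → ∃[ x ] x ∈ S →
                         ∃[ u ] (∀ x → x ∈ S → x ≤ u) → ∃[ s ] IsSupremum S s

  ≤-decTotalOrder : DecTotalOrder 0ℓ 0ℓ 0ℓ
  ≤-decTotalOrder = record
    { isDecTotalOrder = StrictToNonStrict.isDecTotalOrder _≡_ _<_ isStrictTotalOrder }

  _<?_ : ∀ x y → Dec (x < y)
  _<?_ = IsStrictTotalOrder._<?_ isStrictTotalOrder

  _≤?_ : ∀ x y → Dec (x ≤ y)
  _≤?_ = DecTotalOrder._≤?_ ≤-decTotalOrder

  _-_ _/_ : ℝ → ℝ → ℝ
  x - y = x + (- y)
  x / y = x * y ⁻¹

  fromℕ : ℕ → ℝ
  fromℕ zero    = 0ℝ
  fromℕ (suc n) = 1ℝ + fromℕ n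

  sumℝ : List ℝ → ℝ
  sumℝ = foldr _+_ 0ℝ

  partialSum : (ℕ → ℝ) → ℕ → ℝ
  partialSum a zero    = 0ℝ
  partialSum a (suc n) = partialSum a n + a n

module Probability (R : CompleteOrderedField) where
  open CompleteOrderedField R

  -- ℙ is a total function on predicates, but only its values on measurable
  -- ones are constrained or used.
  record ProbabilitySpace : Set₁ where
    field
      Ω          : Set
      Measurable : Pred Ω 0ℓ → Set
      ℙ          : Pred Ω 0ℓ → ℝ

    field
      measurable-resp : ∀ {E F} → E ⊆ F → F ⊆ E → Measurable E → Measurable F
      measurable-U    : Measurable U
      measurable-∁    : ∀ {E} → Measurable E → Measurable (∁ E)
      measurable-⋃    : (E : ℕ → Pred Ω 0ℓ) → (∀ n → Measurable (E n)) → Measurable (⋃ ℕ E)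
      ℙ-resp          : ∀ {E F} → E ⊆ F → F ⊆ E → Measurable E → ℙ E ≡ ℙ F
      ℙ-nonneg        : ∀ {E} → Measurable E → 0ℝ ≤ ℙ E
      ℙ-U             : ℙ U ≡ 1ℝ
      ℙ-⋃             : (E : ℕ → Pred Ω 0ℓ) → (∀ n → Measurable (E n)) →
                        (∀ m n → m ≢ n → Empty (E m ∩ E n)) →
                        IsSupremum (λ v → ∃[ n ] v ≡ partialSum (λ m → ℙ (E m)) n) (ℙ (⋃ ℕ E))

    MeasurableFunction : (Ω → ℝ) → Set
    MeasurableFunction X = ∀ c → Measurable (λ ω → c < X ω)

    -- A simple function Σ c·1_E, with finitely many pairwise disjoint measurable
    -- sets E and coefficients c ≥ 0, lying pointwise below X ≥ 0.
    record SimpleBelow (X : Ω → ℝ) : Set₁ where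
      field
        terms      : List (ℝ × Pred Ω 0ℓ)
        measurable : All (λ (c , E) → Measurable E) terms
        disjoint   : AllPairs (λ (c , E) (d , F) → Empty (E ∩ F)) terms
        nonneg     : All (λ (c , E) → 0ℝ ≤ c) terms
        below      : All (λ (c , E) → ∀ ω → ω ∈ E → c ≤ X ω) terms

      integral : ℝ
      integral = sumℝ (map (λ (c , E) → c * ℙ E) terms)

    -- For nonnegative measurable X the expectation is the Lebesgue integral, i.e.
    -- the supremum in [0,∞] of the integrals of simple functions below X; these
    -- two relations compare that supremum with a real number.
    𝔼[_]≤_ 𝔼[_]>_ : (Ω → ℝ) → ℝ → Set₁
    𝔼[ X ]≤ c = (φ : SimpleBelow X) → SimpleBelow.integral φ ≤ c
    𝔼[ X ]> c = Σ[ φ ∈ SimpleBelow X ] c < SimpleBelow.integral φ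

module DynamicBinPacking (R : CompleteOrderedField) where
  open CompleteOrderedField R
  open Probability R
  open ProbabilitySpace using (Ω)

  record Item : Set where
    field
      arrival size duration : ℝ
      arrival-nonneg        : 0ℝ ≤ arrival
      size-nonneg           : 0ℝ ≤ size
      size≤1                : size ≤ 1ℝ
      duration-pos          : 0ℝ < duration

    end : ℝ
    end = arrival + duration

  open Item

  -- Items are numbered in order of arrival; simultaneous arrivals are revealed
  -- one after the other in this order.
  record Instance : Set where
    field
      n      : ℕ
      item   : Fin n → Item
      sorted : ∀ i j → i Fin.≤ j → arrival (item i) ≤ arrival (item j)

    totalSize : ℝ
    totalSize = sumℝ (map (λ i → size (item i)) (allFin n))

    load : List (Fin n) → (Fin n → ℕ) → ℕ → ℝ
    load is bin b = sumℝ (map (λ i → size (item i)) (filter (λ i → bin i ℕ.≟ b) is))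

    HasDurationRatio : ℝ → Set
    HasDurationRatio μ = ∃[ long ] ∃[ short ]
        (∀ i → duration (item i) ≤ duration (item long))
      × (∀ i → duration (item short) ≤ duration (item i))
      × duration (item long) ≡ μ * duration (item short)

  -- StepIntegral f s v : f is a step function on [s,∞) whose integral there is v.
  data StepIntegral (f : ℝ → ℕ) : ℝ → ℝ → Set where
    tail : ∀ {s} → (∀ t → s ≤ t → f t ≡ 0) → StepIntegral f s 0ℝ
    step : ∀ {s s′ v} k → s ≤ s′ → (∀ t → s ≤ t → t < s′ → f t ≡ k) →
           StepIntegral f s′ v → StepIntegral f s ((s′ - s) * fromℕ k + v)

  module Optimum (I : Instance) where
    open Instance I

    presentAt : ℝ → List (Fin n)
    presentAt t = filter (λ i → (arrival (item i) ≤? t) ×-dec (t <? end (item i))) (allFin n)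

    Packable : ℝ → ℕ → Set
    Packable t k = ∃[ bin ] All (λ i → bin i ℕ.< k) (presentAt t)
                          × (∀ b → load (presentAt t) bin b ≤ 1ℝ)

    IsMinBins : ℝ → ℕ → Set
    IsMinBins t k = Packable t k × (∀ k′ → Packable t k′ → k ℕ.≤ k′)

    IsOPT : ℝ → Set
    IsOPT v = ∃[ opt ] (∀ t → IsMinBins t (opt t)) × StepIntegral opt 0ℝ v

  open Optimum public using (IsOPT)

  -- Everything an online algorithm gets to see: arrival times and sizes, and
  -- which (earlier) item departs when. Durations are never revealed.
  data Observation : Set where
    arrived  : (time size : ℝ) → Observation
    departed : (time : ℝ) (index : ℕ) → Observation

  Assignment : Set
  Assignment = ℕ → ℕ

  record Delayed : Set where
    field
      wait     : ℝ
      wait-pos : 0ℝ < wait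
      bins     : Assignment

  -- The assignment of item indices to bin labels adopted immediately after the
  -- latest observation, followed by the reassignments carried out if nothing
  -- further is observed; each wait counts from the preceding (re)assignment.
  -- Values at items that are not present are irrelevant.
  record Reaction : Set where
    field
      now   : Assignment
      later : List Delayed

  -- The history is listed latest observation first.
  Algorithm : Set
  Algorithm = List Observation → Reaction

  module Execution (I : Instance) where
    open Instance I
    open DecMembership (Fin._≟_ {n}) using () renaming (_∈?_ to _∈?ᶠ_)

    data Event : Set where
      arrive depart : Fin n → Event

    eventTime : Event → ℝ
    eventTime (arrive i) = arrival (item i)
    eventTime (depart i) = end (item i)

    observe : Event → Observation
    observe (arrive i) = arrived (arrival (item i)) (size (item i))
    observe (depart i) = departed (end (item i)) (toℕ i)

    open InsertionSort (On.decTotalOrder ≤-decTotalOrder eventTime) using (sort)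

    -- The sort is stable, so at equal times departures precede arrivals (items
    -- are present on half-open intervals) and ties are otherwise broken by index.
    events : List Event
    events = sort (map depart (allFin n) ++ map arrive (allFin n))

    update : Event → List (Fin n) → List (Fin n)
    update (arrive i) present = i ∷ present
    update (depart i) present = filter (λ j → ¬? (j Fin.≟ i)) present

    record Frame : Set where
      constructor frame
      field
        time    : ℝ
        present : List (Fin n)
        bins    : Assignment

      bin : Fin n → ℕ
      bin i = bins (toℕ i)

      Feasible : Set
      Feasible = ∀ b → load present bin b ≤ 1ℝ

      nonemptyBins : ℕ
      nonemptyBins = length (deduplicate ℕ._≟_ (map bin present))

    open Frame

    delayedFrames : (now next : ℝ) → List (Fin n) → List Delayed → List Frame
    delayedFrames now next p []       = []
    delayedFrames now next p (d ∷ ds) with now + Delayed.wait d <? next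
    ... | yes _ = frame (now + Delayed.wait d) p (Delayed.bins d)
                  ∷ delayedFrames (now + Delayed.wait d) next p ds
    ... | no  _ = []

    framesUntilNext : ℝ → List (Fin n) → List Delayed → List Event → List Frame
    framesUntilNext now p ds []       = []
    framesUntilNext now p ds (e ∷ es) = delayedFrames now (eventTime e) p ds

    runFrom : Algorithm → List Observation → List (Fin n) → List Event → List Frame
    runFrom A h p []       = []
    runFrom A h p (e ∷ es) =
      frame (eventTime e) p′ (Reaction.now r)
      ∷ framesUntilNext (eventTime e) p′ (Reaction.later r) es
      ++ runFrom A h′ p′ es
      where
        h′ = observe e ∷ h
        p′ = update e p
        r  = A h′

    -- Chronological; each frame persists until the time of the next one. The
    -- last frame follows the last departure, so no item is present in it.
    run : Algorithm → List Frame
    run A = runFrom A [] [] events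

    activeTime : List Frame → ℝ
    activeTime []           = 0ℝ
    activeTime (f ∷ [])     = 0ℝ
    activeTime (f ∷ g ∷ fs) = (time g - time f) * fromℕ (nonemptyBins f) + activeTime (g ∷ fs)

    migratedItems : Frame → Frame → List (Fin n)
    migratedItems f g =
      filter (λ i → (i ∈?ᶠ present f) ×-dec ¬? (bin f i ℕ.≟ bin g i)) (present g)

    migrations : List Frame → ℝ
    migrations []           = 0ℝ
    migrations (f ∷ [])     = 0ℝ
    migrations (f ∷ g ∷ fs) =
      sumℝ (map (λ i → size (item i)) (migratedItems f g)) + migrations (g ∷ fs)

  cost migratedSize : Algorithm → Instance → ℝ
  cost         A I = Execution.activeTime I (Execution.run I A)
  migratedSize A I = Execution.migrations I (Execution.run I A)

  record RandomizedAlgorithm : Set₁ where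
    field
      space : ProbabilitySpace

    open ProbabilitySpace space public using (MeasurableFunction; 𝔼[_]≤_; 𝔼[_]>_)

    field
      algorithm           : Ω space → Algorithm
      feasible            : ∀ ω I → All Execution.Frame.Feasible (Execution.run I (algorithm ω))
      cost-measurable     : ∀ I → MeasurableFunction (λ ω → cost (algorithm ω) I)
      migrated-measurable : ∀ I → MeasurableFunction (λ ω → migratedSize (algorithm ω) I)

    -- Expected migrated size is o(total size), as the total size tends to
    -- infinity, on the instances of duration ratio μ.
    SublinearMigration : ℝ → Set₁
    SublinearMigration μ =
      ∀ ε → 0ℝ < ε → ∃[ S ] ∀ I → Instance.HasDurationRatio I μ → S ≤ Instance.totalSize I →
        𝔼[ (λ ω → migratedSize (algorithm ω) I) ]≤ (ε * Instance.totalSize I)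

    CompetitiveRatioAtLeast : (μ γ : ℝ) → Set₁
    CompetitiveRatioAtLeast μ γ =
      ∀ β → β < γ → ∃[ I ] Instance.HasDurationRatio I μ
        × ∃[ v ] IsOPT I v × (𝔼[ (λ ω → cost (algorithm ω) I) ]> (β * v))

{-# OPTIONS --safe #-}
module Submission where

-- Items of size 1/K arrive at time 0 in G groups of 2K; one uniformly random
-- item per group lasts μ, all others last 1.  Before time 1 the algorithm cannot
-- see the choice.  A bin holds at most K items, so two survivors share a bin
-- rarely enough that the survivors lie in at least G/2 bins on average.  Their
-- total size G/K is a constant fraction 1/(2K) of the whole, hence o(total size)
-- of migration empties only a small fraction of these bins, and the expected cost
-- is about μG/2.  The optimum is 2G on [0,1) and G/K on [1,μ), less than 5G/2 in
-- total once K ≥ 2μ.  With total losses of about G/12 this gives the ratio μ/6.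
--
-- The average over the choices is taken before the expectation: as only the
-- events {cost > c} and {migrated size > c} are measurable, the cost is bounded
-- below by a layer-cake simple function with levels μ, 2μ, …, Gμ, and the
-- averaging inequality is one between finite sums of indicators of such events.

open import Defs
open import Algebra.Bundles using (CommutativeRing)
import Algebra.Solver.Ring.NaturalCoefficients.Default as SemiringSolver
open import Data.Empty using (⊥-elim)
open import Data.Fin.Base as Fin using (Fin; toℕ; combine; quotient; remainder; _↑ˡ_; _↑ʳ_)
import Data.Fin.Properties as Fin
open import Data.List.Base
  using (List; []; _∷_; _++_; _ʳ++_; map; foldl; filter; length; allFin; tabulate; upTo; downFrom;
         deduplicate; cartesianProduct; cartesianProductWith)
import Data.List.Properties as List
import Data.List.Membership.DecPropositional as DecMembership
open import Data.List.Membership.Propositional using (_∈_)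
open import Data.List.Membership.Propositional.Properties
  using (∈-∃++; ∈-++⁺ˡ; ∈-++⁺ʳ; ∈-++⁻; ∈-map⁺; ∈-map⁻; ∈-filter⁺; ∈-filter⁻;
         ∈-deduplicate⁺; ∈-deduplicate⁻; ∈-upTo⁺; ∈-allFin; ∈-tabulate⁺; ∈-tabulate⁻)
open import Data.List.Relation.Binary.Permutation.Propositional using (↭-sym)
open import Data.List.Relation.Binary.Permutation.Propositional.Properties using (All-resp-↭; ∈-resp-↭)
open import Data.List.Relation.Binary.Subset.Propositional using (_⊆_)
open import Data.List.Relation.Unary.All as All using (All; []; _∷_)
import Data.List.Relation.Unary.All.Properties as All
open import Data.List.Relation.Unary.AllPairs using (AllPairs; []; _∷_)
open import Data.List.Relation.Unary.Any as Any using (Any; here; there)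
import Data.List.Relation.Unary.Any.Properties as Any
open import Data.List.Relation.Unary.Linked using (Linked; [-]; _∷_)
import Data.List.Relation.Unary.Linked.Properties as Linked
open import Data.List.Relation.Unary.Unique.DecPropositional.Properties using (deduplicate-!)
open import Data.List.Relation.Unary.Unique.Propositional using (Unique)
import Data.List.Relation.Unary.Unique.Propositional.Properties as Unique
import Data.List.Sort.InsertionSort.Base as InsertionSort
import Data.List.Sort.InsertionSort.Properties as InsertionSortProperties
open import Data.Maybe.Base using (Maybe; just; nothing)
open import Data.Nat.Base as ℕ using (ℕ; zero; suc)
open import Data.Nat.DivMod using (m≡m%n+[m/n]*n; m%n<n; m<n*o⇒m/o<n)
open import Data.Nat.ListAction using (sum)
import Data.Nat.Properties as ℕ
open import Data.Nat.Solver using (module +-*-Solver)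
open import Data.Product.Base using (_×_; _,_; proj₁; proj₂; ∃-syntax)
open import Data.Sum.Base using (_⊎_; inj₁; inj₂; [_,_])
open import Data.Vec.Base using (Vec; []; _∷_; lookup; replicate)
open import Function.Base using (_∘_; id)
open import Level using (0ℓ)
open import Relation.Binary.Bundles using (DecTotalOrder)
import Relation.Binary.Construct.On as On
open import Relation.Binary.Definitions using (tri<; tri≈; tri>)
open import Relation.Binary.PropositionalEquality using
    (_≡_; _≢_; refl; sym; trans; cong; cong₂; subst; resp₂; module ≡-Reasoning)
import Relation.Binary.Reasoning.Base.Triple as Triple
open import Relation.Binary.Structures using (IsStrictTotalOrder)
open import Relation.Nullary.Decidable using (Dec; yes; no; _×-dec_; ¬?)
open import Relation.Nullary.Negation using (¬_)
open import Relation.Unary using (Pred; Decidable; ∁; U; ∅; Empty; _∩_; _∪_; ⋃) renaming (_⊆_ to _⊆ᵉ_)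

-- The obstacle is adaptivity: once the short items depart, the algorithm knows the survivors, and
-- only its migration budget keeps it from gathering them. All items have size `1/K`, so a bound on
-- migrated size is a bound on the number of moved items, but with a factor `K`. Hence `K` must not
-- grow with the instance: it depends on `μ` alone, which lets the migration rate
-- `ε = 1/(48 * 24 * K)` be fixed before the hypothesis returns its threshold `S`. Only then is
-- `q ≥ S` taken, and `G = 24 * K * q`. A group has `2 * K` items, twice the capacity of a bin, so
-- that a given bin receives a later survivor with probability at most 1/2. In units of `K * q`: the
-- survivors start in 12 bins on average; runs migrating at most `q` free at most 1; the other runs
-- have probability at most 1/24 by Markov and, charged `G` bins each, cost 1 more; 10 remain. The
-- optimum is at most 48 on [0,1) and 12 afterwards, and 10/60 is the constant 1/6. The rounding
-- loss of one bin is paid from the surplus in the estimate of the optimum.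

module Counting where
  open import Data.Nat.Base using (_+_; _*_; _^_; _∸_; _≤_; _<_; _/_; _%_; z≤n; s≤s; NonZero)
  open import Data.Nat.Properties

  private
    variable
      A B : Set

  -- Numbers of distinct bin labels.

  unique-⊆⇒length-≤ : ∀ {xs ys : List A} → Unique xs → xs ⊆ ys → length xs ≤ length ys
  unique-⊆⇒length-≤ {xs = []}     _          _  = z≤n
  unique-⊆⇒length-≤ {xs = x ∷ xs} (x≢ ∷ xs!) xs⊆ with ∈-∃++ (xs⊆ (here refl))
  ... | as , bs , refl = begin
    suc (length xs)           ≤⟨ s≤s (unique-⊆⇒length-≤ xs! skip) ⟩
    suc (length (as ++ bs))   ≡⟨ cong suc (List.length-++ as) ⟩
    suc (length as + length bs) ≡⟨ +-suc (length as) (length bs) ⟨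
    length as + length (x ∷ bs) ≡⟨ List.length-++ as ⟨
    length (as ++ x ∷ bs)     ∎
    where
    open ≤-Reasoning
    skip : xs ⊆ as ++ bs
    skip z∈xs with ∈-++⁻ as (xs⊆ (there z∈xs))
    ... | inj₁ z∈as         = ∈-++⁺ˡ z∈as
    ... | inj₂ (here refl)  = ⊥-elim (All.lookup x≢ z∈xs refl)
    ... | inj₂ (there z∈bs) = ∈-++⁺ʳ as z∈bs

  -- Unfolds to the same expression as `nonemptyBins`, so bounds on it apply to frames without
  -- conversion.
  distinct : List ℕ → ℕ
  distinct xs = length (deduplicate _≟_ xs)

  unique-⊆⇒length≤distinct : ∀ {xs ys} → Unique xs → xs ⊆ ys → length xs ≤ distinct ys
  unique-⊆⇒length≤distinct xs! xs⊆ys = unique-⊆⇒length-≤ xs! (∈-deduplicate⁺ _≟_ ∘ xs⊆ys)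

  distinct-mono : ∀ {xs ys} → xs ⊆ ys → distinct xs ≤ distinct ys
  distinct-mono {xs} xs⊆ys =
    unique-⊆⇒length≤distinct (deduplicate-! _≟_ xs) (xs⊆ys ∘ ∈-deduplicate⁻ _≟_ xs)

  -- A label of `u` that `v` does not use must come from an element on which the two differ. With
  -- `u` and `v` the assignments before and after a migration, each moved item frees at most one
  -- bin.
  distinct-map : ∀ (u v : A → ℕ) xs →
    distinct (map u xs) ≤ distinct (map v xs) + length (filter (λ x → ¬? (u x ≟ v x)) xs)
  distinct-map u v xs = begin
    distinct (map u xs)                          ≤⟨ unique-⊆⇒length-≤ (deduplicate-! _≟_ (map u xs)) covered ⟩
    length (deduplicate _≟_ (map v xs) ++ map u changed) ≡⟨ List.length-++ (deduplicate _≟_ (map v xs)) ⟩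
    distinct (map v xs) + length (map u changed) ≡⟨ cong (distinct (map v xs) +_) (List.length-map u changed) ⟩
    distinct (map v xs) + length changed         ∎
    where
    open ≤-Reasoning
    changed = filter (λ x → ¬? (u x ≟ v x)) xs
    covered : deduplicate _≟_ (map u xs) ⊆ deduplicate _≟_ (map v xs) ++ map u changed
    covered z∈ with ∈-map⁻ u (∈-deduplicate⁻ _≟_ (map u xs) z∈)
    ... | x , x∈xs , refl with u x ≟ v x
    ... | yes ux≡vx = ∈-++⁺ˡ (∈-deduplicate⁺ _≟_ (subst (_∈ map v xs) (sym ux≡vx) (∈-map⁺ v x∈xs)))
    ... | no  ux≢vx = ∈-++⁺ʳ _ (∈-map⁺ u (∈-filter⁺ (λ x → ¬? (u x ≟ v x)) x∈xs ux≢vx))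

  𝟙 : ∀ {P : Set} → Dec P → ℕ
  𝟙 (yes _) = 1
  𝟙 (no  _) = 0

  open DecMembership _≟_ using (_∈?_)

  -- The case distinction is put into an indicator and kept on the larger side, so that the
  -- inequality can be summed over all choices without subtraction.
  distinct-∷ : ∀ x xs → suc (distinct xs) ≤ distinct (x ∷ xs) + 𝟙 (x ∈? xs)
  distinct-∷ x xs with x ∈? xs
  ... | yes _   = ≤-trans (s≤s (distinct-mono {xs} there)) (≤-reflexive (sym (+-comm _ 1)))
  ... | no x∉xs = ≤-trans (unique-⊆⇒length≤distinct (new ∷ deduplicate-! _≟_ xs) sub) (m≤m+n _ 0)
    where
    new : All (x ≢_) (deduplicate _≟_ xs)
    new = All.tabulate λ { y∈ refl → x∉xs (∈-deduplicate⁻ _≟_ xs y∈) }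
    sub : x ∷ deduplicate _≟_ xs ⊆ x ∷ xs
    sub (here refl) = here refl
    sub (there y∈)  = there (∈-deduplicate⁻ _≟_ xs y∈)

  distinct≤length : ∀ xs → distinct xs ≤ length xs
  distinct≤length = List.length-deduplicate _≟_

  -- Finite sums and averages over the random choices.

  ∑ : List A → (A → ℕ) → ℕ
  ∑ xs f = sum (map f xs)

  ∑-mono : ∀ (xs : List A) {f g} → (∀ x → f x ≤ g x) → ∑ xs f ≤ ∑ xs g
  ∑-mono []       f≤g = z≤n
  ∑-mono (x ∷ xs) f≤g = +-mono-≤ (f≤g x) (∑-mono xs f≤g)

  ∑-cong : ∀ (xs : List A) {f g} → (∀ x → f x ≡ g x) → ∑ xs f ≡ ∑ xs g
  ∑-cong xs f≡g = cong sum (List.map-cong f≡g xs)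

  ∑-+ : ∀ (xs : List A) f g → ∑ xs (λ x → f x + g x) ≡ ∑ xs f + ∑ xs g
  ∑-+ []       f g = refl
  ∑-+ (x ∷ xs) f g = trans (cong (f x + g x +_) (∑-+ xs f g))
    (solve 4 (λ a b c d → a :+ b :+ (c :+ d) := a :+ c :+ (b :+ d)) refl (f x) (g x) (∑ xs f) (∑ xs g))
    where open +-*-Solver

  ∑-*ˡ : ∀ (xs : List A) c f → ∑ xs (λ x → c * f x) ≡ c * ∑ xs f
  ∑-*ˡ []       c f = sym (*-zeroʳ c)
  ∑-*ˡ (x ∷ xs) c f = trans (cong (c * f x +_) (∑-*ˡ xs c f)) (sym (*-distribˡ-+ c (f x) (∑ xs f)))

  ∑-*ʳ : ∀ (xs : List A) f c → ∑ xs (λ x → f x * c) ≡ ∑ xs f * c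
  ∑-*ʳ xs f c = trans (∑-cong xs (λ x → *-comm (f x) c)) (trans (∑-*ˡ xs c f) (*-comm c _))

  ∑-const : ∀ (xs : List A) c → ∑ xs (λ _ → c) ≡ length xs * c
  ∑-const []       c = refl
  ∑-const (x ∷ xs) c = cong (c +_) (∑-const xs c)

  ∑-++ : ∀ (xs ys : List A) f → ∑ (xs ++ ys) f ≡ ∑ xs f + ∑ ys f
  ∑-++ []       ys f = refl
  ∑-++ (x ∷ xs) ys f = trans (cong (f x +_) (∑-++ xs ys f)) (sym (+-assoc (f x) _ _))

  ∑-map : ∀ (h : A → B) xs f → ∑ (map h xs) f ≡ ∑ xs (f ∘ h)
  ∑-map h xs f = cong sum (sym (List.map-∘ xs))

  ∑-cartesianProductWith : ∀ {C : Set} (h : A → B → C) xs ys f →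
    ∑ (cartesianProductWith h xs ys) f ≡ ∑ xs (λ x → ∑ ys (λ y → f (h x y)))
  ∑-cartesianProductWith h []       ys f = refl
  ∑-cartesianProductWith h (x ∷ xs) ys f = trans (∑-++ (map (h x) ys) _ f)
    (cong₂ _+_ (∑-map (h x) ys f) (∑-cartesianProductWith h xs ys f))

  length-filter-∑ : ∀ {P : Pred A 0ℓ} (P? : Decidable P) xs → length (filter P? xs) ≡ ∑ xs (λ x → 𝟙 (P? x))
  length-filter-∑ P? []       = refl
  length-filter-∑ P? (x ∷ xs) with P? x
  ... | yes _ = cong suc (length-filter-∑ P? xs)
  ... | no  _ = length-filter-∑ P? xs

  ∑-allFin-suc : ∀ n (f : Fin (suc n) → ℕ) → ∑ (allFin (suc n)) f ≡ f Fin.zero + ∑ (allFin n) (f ∘ Fin.suc)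
  ∑-allFin-suc n f = cong (f Fin.zero +_)
    (trans (cong sum (List.map-tabulate Fin.suc f)) (sym (cong sum (List.map-tabulate (λ i → i) (f ∘ Fin.suc)))))

  ∑-allFin-+ : ∀ m n (f : Fin (m + n) → ℕ) →
    ∑ (allFin (m + n)) f ≡ ∑ (allFin m) (λ i → f (i ↑ˡ n)) + ∑ (allFin n) (λ i → f (m ↑ʳ i))
  ∑-allFin-+ zero    n f = refl
  ∑-allFin-+ (suc m) n f = begin
    ∑ (allFin (suc m + n)) f ≡⟨ ∑-allFin-suc (m + n) f ⟩
    f Fin.zero + ∑ (allFin (m + n)) (f ∘ Fin.suc) ≡⟨ cong (f Fin.zero +_) (∑-allFin-+ m n (f ∘ Fin.suc)) ⟩
    f Fin.zero + (left + right) ≡⟨ +-assoc (f Fin.zero) left right ⟨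
    f Fin.zero + left + right ≡⟨ cong (_+ right) (∑-allFin-suc m (λ i → f (i ↑ˡ n))) ⟨
    ∑ (allFin (suc m)) (λ i → f (i ↑ˡ n)) + right ∎
    where
    open ≡-Reasoning
    left  = ∑ (allFin m) (λ i → f (Fin.suc (i ↑ˡ n)))
    right = ∑ (allFin n) (λ i → f (suc m ↑ʳ i))

  -- The uniform distribution of the adversary, as a list of its equally likely outcomes; an
  -- expectation is a sum over this list, multiplied out by `m ^ G`.
  choices : ∀ m G → List (Vec (Fin m) G)
  choices m zero    = [] ∷ []
  choices m (suc G) = cartesianProductWith _∷_ (allFin m) (choices m G)

  ∑-choices : ∀ m G (f : Vec (Fin m) (suc G) → ℕ) →
    ∑ (choices m (suc G)) f ≡ ∑ (allFin m) (λ j → ∑ (choices m G) (λ r → f (j ∷ r)))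
  ∑-choices m G f = ∑-cartesianProductWith _∷_ (allFin m) (choices m G) f

  ∑-choices-const : ∀ m G c → ∑ (choices m G) (λ _ → c) ≡ m ^ G * c
  ∑-choices-const m zero    c = refl
  ∑-choices-const m (suc G) c = begin
    ∑ (choices m (suc G)) (λ _ → c)       ≡⟨ ∑-choices m G (λ _ → c) ⟩
    ∑ (allFin m) (λ _ → ∑ (choices m G) (λ _ → c)) ≡⟨ ∑-const (allFin m) _ ⟩
    length (allFin m) * ∑ (choices m G) (λ _ → c) ≡⟨ cong₂ _*_ (List.length-tabulate {n = m} (λ i → i))
        (∑-choices-const m G c) ⟩
    m * (m ^ G * c)                       ≡⟨ *-assoc m (m ^ G) c ⟨
    m ^ suc G * c                         ∎
    where open ≡-Reasoning

  length-choices : ∀ m G → length (choices m G) ≡ m ^ G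
  length-choices m G = trans (sym (*-identityʳ _))
      (trans (sym (∑-const (choices m G) 1)) (trans (∑-choices-const m G 1) (*-identityʳ _)))

  -- β g j is the bin of the j-th item of group g.
  picked : ∀ {m G} → (Fin G → Fin m → ℕ) → Vec (Fin m) G → List ℕ
  picked β []      = []
  picked β (j ∷ r) = β Fin.zero j ∷ picked (β ∘ Fin.suc) r

  occurrences : ∀ {m} G → (Fin G → Fin m → ℕ) → ℕ → ℕ
  occurrences         zero    β x = 0
  occurrences {m = m} (suc G) β x =
    ∑ (allFin m) (λ j → 𝟙 (β Fin.zero j ≟ x)) + occurrences G (β ∘ Fin.suc) x

  -- `occurrences` recurses over groups like `picked`, which suits the induction; feasibility of a
  -- packing bounds the count over the flat item numbers. This lemma joins the two views.
  occurrences-combine : ∀ {m} G (b : Fin (G * m) → ℕ) x →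
    occurrences {m} G (λ g j → b (combine g j)) x ≡ ∑ (allFin (G * m)) (λ i → 𝟙 (b i ≟ x))
  occurrences-combine         zero    b x = refl
  occurrences-combine {m = m} (suc G) b x = trans
    (cong (∑ (allFin m) (λ j → 𝟙 (b (j ↑ˡ (G * m)) ≟ x)) +_) (occurrences-combine G (λ i → b (m ↑ʳ i)) x))
    (sym (∑-allFin-+ m (G * m) _))

  𝟙-⊎ : ∀ {P Q S : Set} (p : Dec P) (q : Dec Q) (s : Dec S) → (P → Q ⊎ S) → 𝟙 p ≤ 𝟙 q + 𝟙 s
  𝟙-⊎ (no _)  _       _       _ = z≤n
  𝟙-⊎ (yes _) (yes _) _       _ = s≤s z≤n
  𝟙-⊎ (yes _) (no _)  (yes _) _ = ≤-refl
  𝟙-⊎ (yes p) (no ¬q) (no ¬s) f = ⊥-elim ([ ¬q , ¬s ] (f p))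

  𝟙-∈?-∷ : ∀ x y ys → 𝟙 (x ∈? (y ∷ ys)) ≤ 𝟙 (y ≟ x) + 𝟙 (x ∈? ys)
  𝟙-∈?-∷ x y ys = 𝟙-⊎ (x ∈? (y ∷ ys)) (y ≟ x) (x ∈? ys)
    λ { (here x≡y) → inj₁ (sym x≡y) ; (there x∈ys) → inj₂ x∈ys }

  -- The union bound for the probability that a random choice hits the bin x.
  ∑-hits : ∀ {m} G (β : Fin G → Fin m → ℕ) x →
    m * ∑ (choices m G) (λ r → 𝟙 (x ∈? picked β r)) ≤ occurrences G β x * m ^ G
  ∑-hits {m} zero    β x = ≤-reflexive (*-zeroʳ m)
  ∑-hits {m} (suc G) β x = begin
    m * ∑ (choices m (suc G)) hit
      ≡⟨ cong (m *_) (∑-choices m G hit) ⟩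
    m * ∑ (allFin m) (λ j → ∑ (choices m G) (λ r → hit (j ∷ r)))
      ≤⟨ *-monoʳ-≤ m (∑-mono (allFin m) λ j → ∑-mono (choices m G) λ r → 𝟙-∈?-∷ x (β Fin.zero j) _) ⟩
    m * ∑ (allFin m) (λ j → ∑ (choices m G) (λ r → first j + hit′ r))
      ≡⟨ cong (m *_) (∑-cong (allFin m) λ j → trans (∑-+ (choices m G) _ hit′)
          (cong (_+ H) (trans (∑-choices-const m G (first j)) (*-comm (m ^ G) (first j))))) ⟩
    m * ∑ (allFin m) (λ j → first j * m ^ G + H)
      ≡⟨ cong (m *_) (trans (∑-+ (allFin m) _ (λ _ → H))
          (cong₂ _+_ (∑-*ʳ (allFin m) first (m ^ G)) (∑-const (allFin m) H))) ⟩
    m * (∑ (allFin m) first * m ^ G + length (allFin m) * H)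
      ≡⟨ cong (λ l → m * (∑ (allFin m) first * m ^ G + l * H)) (List.length-tabulate {n = m} (λ i → i)) ⟩
    m * (∑ (allFin m) first * m ^ G + m * H)
      ≤⟨ *-monoʳ-≤ m (+-monoʳ-≤ (∑ (allFin m) first * m ^ G) (∑-hits G (β ∘ Fin.suc) x)) ⟩
    m * (∑ (allFin m) first * m ^ G + occurrences G (β ∘ Fin.suc) x * m ^ G)
      ≡⟨ solve 4 (λ a b c d → a :* (b :* d :+ c :* d) := (b :+ c) :* (a :* d)) refl m (∑ (allFin m) first)
          (occurrences G (β ∘ Fin.suc) x) (m ^ G) ⟩
    occurrences (suc G) β x * m ^ suc G ∎
    where
    open ≤-Reasoning
    open +-*-Solver
    hit   = λ r → 𝟙 (x ∈? picked β r)
    hit′  = λ r → 𝟙 (x ∈? picked (β ∘ Fin.suc) r)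
    first = λ j → 𝟙 (β Fin.zero j ≟ x)
    H     = ∑ (choices m G) hit′

  -- A pick lands in a bin that later picks hit with probability at most K / (2 * K).
  ∑-distinct : ∀ K .{{_ : NonZero K}} G (β : Fin G → Fin (2 * K) → ℕ) → (∀ x → occurrences G β x ≤ K) →
    G * (2 * K) ^ G ≤ 2 * ∑ (choices (2 * K) G) (λ r → distinct (picked β r))
  ∑-distinct K zero    β occ≤K = z≤n
  -- Adding `m * R` to both sides lets the first pick count as a full new bin, worth `2 * (m * R)`
  -- on the doubled scale; `hits≤` takes back at most `m * R` of this, leaving half a bin per group.
  ∑-distinct K (suc G) β occ≤K = +-cancelʳ-≤ (m * R) _ _ (begin
    suc G * (m * R) + m * R
      ≡⟨ solve 3 (λ g m r → (con 1 :+ g) :* (m :* r) :+ m :* r := m :* (con 2 :* r :+ g :* r)) refl G m R ⟩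
    m * (2 * R + G * R)
      ≤⟨ *-monoʳ-≤ m (+-monoʳ-≤ (2 * R) (∑-distinct K G β′ occ′≤K)) ⟩
    m * (2 * R + 2 * ∑ (choices m G) dist)
      ≡⟨ cong (m *_) (sym (*-distribˡ-+ 2 R (∑ (choices m G) dist))) ⟩
    m * (2 * (R + ∑ (choices m G) dist))
      ≡⟨ solve 2 (λ m x → m :* (con 2 :* x) := con 2 :* (m :* x)) refl m _ ⟩
    2 * (m * (R + ∑ (choices m G) dist))
      ≡⟨ cong (λ z → 2 * (m * z))
          (trans (cong (_+ ∑ (choices m G) dist)
          (trans (sym (*-identityʳ R)) (sym (∑-choices-const m G 1))))
          (sym (∑-+ (choices m G) (λ _ → 1) dist))) ⟩
    2 * (m * ∑ (choices m G) (λ r → suc (dist r)))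
      ≡⟨ cong (2 *_) (trans (sym
          (cong (_* ∑ (choices m G) (λ r → suc (dist r))) (List.length-tabulate {n = m} (λ i → i))))
          (sym (∑-const (allFin m) _))) ⟩
    2 * ∑ (allFin m) (λ j → ∑ (choices m G) (λ r → suc (dist r)))
      ≤⟨ *-monoʳ-≤ 2 (∑-mono (allFin m) λ j → ∑-mono (choices m G) λ r → distinct-∷ (β Fin.zero j) (picked β′ r)) ⟩
    2 * ∑ (allFin m) (λ j → ∑ (choices m G) (λ r → distinct (picked β (j ∷ r)) + hit j r))
      ≡⟨ cong (2 *_) (trans (∑-cong (allFin m) λ j → ∑-+ (choices m G) _ (hit j)) (∑-+ (allFin m) _ _)) ⟩
    2 * (∑ (allFin m) (λ j → ∑ (choices m G) (λ r → distinct (picked β (j ∷ r))))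
        + ∑ (allFin m) (λ j → ∑ (choices m G) (hit j)))
      ≡⟨ *-distribˡ-+ 2 (∑ (allFin m) (λ j → ∑ (choices m G) (λ r → distinct (picked β (j ∷ r)))))
          (∑ (allFin m) (λ j → ∑ (choices m G) (hit j))) ⟩
    2 * ∑ (allFin m) (λ j → ∑ (choices m G) (λ r → distinct (picked β (j ∷ r))))
        + 2 * ∑ (allFin m) (λ j → ∑ (choices m G) (hit j))
      ≤⟨ +-mono-≤ (≤-reflexive (cong (2 *_) (sym (∑-choices m G (λ r → distinct (picked β r)))))) hits≤ ⟩
    2 * ∑ (choices m (suc G)) (λ r → distinct (picked β r)) + m * R ∎)
    where
    open ≤-Reasoning
    open +-*-Solver
    m    = 2 * K
    R    = m ^ G
    β′   = β ∘ Fin.suc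
    dist = λ r → distinct (picked β′ r)
    hit  = λ j r → 𝟙 (β Fin.zero j ∈? picked β′ r)
    occ′≤K : ∀ x → occurrences G β′ x ≤ K
    occ′≤K x = ≤-trans (m≤n+m _ _) (occ≤K x)
    hit≤ : ∀ j → 2 * ∑ (choices m G) (hit j) ≤ R
    -- Here `m = 2 * K` enters: the union bound gives `occurrences / m`, at most `K / (2 * K)`, as
    -- the probability of a hit.
    hit≤ j = *-cancelˡ-≤ K (begin
      K * (2 * ∑ (choices m G) (hit j)) ≡⟨ solve 2 (λ k h → k :* (con 2 :* h) := (con 2 :* k) :* h) refl K _ ⟩
      m * ∑ (choices m G) (hit j)       ≤⟨ ∑-hits G β′ (β Fin.zero j) ⟩
      occurrences G β′ (β Fin.zero j) * R ≤⟨ *-monoˡ-≤ R (occ′≤K _) ⟩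
      K * R                             ∎)
    hits≤ : 2 * ∑ (allFin m) (λ j → ∑ (choices m G) (hit j)) ≤ m * R
    hits≤ = begin
      2 * ∑ (allFin m) (λ j → ∑ (choices m G) (hit j)) ≡⟨ ∑-*ˡ (allFin m) 2 _ ⟨
      ∑ (allFin m) (λ j → 2 * ∑ (choices m G) (hit j)) ≤⟨ ∑-mono (allFin m) hit≤ ⟩
      ∑ (allFin m) (λ _ → R)                           ≡⟨ ∑-const (allFin m) R ⟩
      length (allFin m) * R                            ≡⟨ cong (_* R) (List.length-tabulate {n = m} (λ i → i)) ⟩
      m * R                                            ∎

  -- Filtered lists and counting against the bin capacity.

  module _ {P : Pred A 0ℓ} (P? : Decidable P) where

    length-filter-¬? : ∀ xs → length xs ≡ length (filter P? xs) + length (filter (¬? ∘ P?) xs)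
    length-filter-¬? []       = refl
    length-filter-¬? (x ∷ xs) with P? x
    ... | yes _ = cong suc (length-filter-¬? xs)
    ... | no  _ = trans (cong suc (length-filter-¬? xs)) (sym (+-suc _ _))

    length-filter-filter : ∀ {Q : Pred A 0ℓ} (Q? : Decidable Q) xs →
      length (filter Q? (filter P? xs)) ≤ length (filter Q? xs)
    length-filter-filter Q? [] = z≤n
    length-filter-filter Q? (x ∷ xs) with P? x | Q? x in eq
    ... | no  _ | yes _ = m≤n⇒m≤1+n (length-filter-filter Q? xs)
    ... | no  _ | no  _ = length-filter-filter Q? xs
    ... | yes _ | yes _ rewrite eq = s≤s (length-filter-filter Q? xs)
    ... | yes _ | no  _ rewrite eq = length-filter-filter Q? xs

    -- Injectivity of `h` is asked only on `P` and relative to `f`. This covers both residues modulo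
    -- `K` inside one block and numberings that separate only the items present at a given time.
    unique-map-filter : ∀ (f h : A → ℕ) → (∀ {x y} → P x → P y → h x ≡ h y → f x ≡ f y) →
      ∀ xs → Unique (map f xs) → Unique (map h (filter P? xs))
    unique-map-filter f h inj []       _            = []
    unique-map-filter f h inj (x ∷ xs) (x∉ ∷ xs!) with P? x
    ... | no  _  = unique-map-filter f h inj xs xs!
    ... | yes px = All.tabulate new ∷ unique-map-filter f h inj xs xs!
      where
      new : ∀ {z} → z ∈ map h (filter P? xs) → h x ≢ z
      new z∈ hx≡z with ∈-map⁻ h z∈
      ... | y , y∈ , refl with ∈-filter⁻ P? {xs = xs} y∈
      ... | y∈xs , py = All.lookup x∉ (∈-map⁺ f y∈xs) (inj px py hx≡z)

  -- Induction on the number of bins, removing the contents of the highest one. This is the volume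
  -- lower bound for the optimum.
  length≤bins*capacity : ∀ {K} k (b : A → ℕ) (xs : List A) → All (λ x → b x < k) xs →
    (∀ c → length (filter (λ x → b x ≟ c) xs) ≤ K) → length xs ≤ k * K
  length≤bins*capacity zero    b []       _        _   = z≤n
  length≤bins*capacity zero    b (x ∷ xs) (() ∷ _) _
  length≤bins*capacity {A = A} {K = K} (suc k) b xs xs<  cap = begin
    length xs                                         ≡⟨ length-filter-¬? top? xs ⟩
    length (filter top? xs) + length lower            ≤⟨ +-mono-≤ (cap k)
        (length≤bins*capacity k b lower lower< cap′) ⟩
    K + k * K                                         ∎
    where
    open ≤-Reasoning
    top? : ∀ x → Dec (b x ≡ k)
    top? x = b x ≟ k
    lower = filter (¬? ∘ top?) xs
    lower< : All (λ x → b x < k) lower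
    lower< = All.tabulate λ x∈ → let x∈xs , bx≢k = ∈-filter⁻ (¬? ∘ top?) x∈ in
      ≤∧≢⇒< (≤-pred (All.lookup xs< x∈xs)) bx≢k
    cap′ : ∀ c → length (filter (λ x → b x ≟ c) lower) ≤ K
    cap′ c = ≤-trans (length-filter-filter (¬? ∘ top?) (λ x → b x ≟ c) xs) (cap c)

  -- Indices with equal quotient differ in their residue, and there are only `K` residues. Thus
  -- filling bins in blocks of `K` consecutive indices never exceeds the capacity.
  length-block≤ : ∀ K .{{_ : NonZero K}} (idx : A → ℕ) xs c → Unique (map idx xs) →
    length (filter (λ x → idx x / K ≟ c) xs) ≤ K
  length-block≤ {A = A} K idx xs c idx! = begin
    length (filter block? xs)                      ≡⟨ List.length-map (λ x → idx x % K) (filter block? xs) ⟨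
    length (map (λ x → idx x % K) (filter block? xs)) ≤⟨ unique-⊆⇒length-≤ residues! bound ⟩
    length (upTo K)                                ≡⟨ List.length-upTo K ⟩
    K                                              ∎
    where
    open ≤-Reasoning
    block? : ∀ x → Dec (idx x / K ≡ c)
    block? x = idx x / K ≟ c
    same : ∀ {x y} → idx x / K ≡ c → idx y / K ≡ c → idx x % K ≡ idx y % K → idx x ≡ idx y
    same {x} {y} x/ y/ x% = trans (m≡m%n+[m/n]*n (idx x) K)
      (trans (cong₂ (λ a b → a + b * K) x% (trans x/ (sym y/))) (sym (m≡m%n+[m/n]*n (idx y) K)))
    residues! = unique-map-filter block? idx (λ x → idx x % K) same xs idx!
    bound : map (λ x → idx x % K) (filter block? xs) ⊆ upTo K
    bound z∈ with ∈-map⁻ (λ x → idx x % K) z∈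
    ... | x , _ , refl = ∈-upTo⁺ (m%n<n (idx x) K)

  tabulate-lookup≡picked : ∀ {m G} (β : Fin G → Fin m → ℕ) r → tabulate (λ g → β g (lookup r g)) ≡ picked β r
  tabulate-lookup≡picked β []      = refl
  tabulate-lookup≡picked β (j ∷ r) = cong (β Fin.zero j ∷_) (tabulate-lookup≡picked (β ∘ Fin.suc) r)

  length-picked : ∀ {m G} (β : Fin G → Fin m → ℕ) r → length (picked β r) ≡ G
  length-picked β []      = refl
  length-picked β (j ∷ r) = cong suc (length-picked (β ∘ Fin.suc) r)

  ∃≢ : ∀ {m} → 2 ≤ m → (i : Fin m) → ∃[ j ] i ≢ j
  ∃≢ (s≤s (s≤s _)) Fin.zero    = Fin.suc Fin.zero , λ ()
  ∃≢ (s≤s (s≤s _)) (Fin.suc _) = Fin.zero , λ ()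

  <-∸ : ∀ a b {d} → d < a ∸ b → suc d + b ≤ a
  <-∸ a       zero    {d} d<  = subst (_≤ a) (sym (+-identityʳ (suc d))) d<
  <-∸ (suc a) (suc b) {d} d<  = subst (_≤ suc a) (sym (+-suc (suc d) b)) (s≤s (<-∸ a b d<))

open Counting

-- Ordered-field arithmetic, excluded middle and real sums.

module OrderedFieldProperties (R : CompleteOrderedField) where
  open CompleteOrderedField R
  open IsStrictTotalOrder isStrictTotalOrder using (compare) renaming
      (trans to <-trans; irrefl to <-irrefl; asym to <-asym) public

  commutativeRing : CommutativeRing _ _
  commutativeRing = record { isCommutativeRing = isCommutativeRing }

  open CommutativeRing commutativeRing public
    using (+-assoc; +-comm; +-identityˡ; +-identityʳ; -‿inverseˡ; -‿inverseʳ;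
           *-assoc; *-comm; *-identityˡ; *-identityʳ; distribˡ; distribʳ; zeroˡ; zeroʳ)
  open SemiringSolver (CommutativeRing.commutativeSemiring commutativeRing) public
    using (solve; _:=_; _:+_; _:*_; con)

  open DecTotalOrder ≤-decTotalOrder public
    using () renaming (refl to ≤-refl; trans to ≤-trans; antisym to ≤-antisym; reflexive to ≤-reflexive; isPreorder to ≤-isPreorder)

  <⇒≤ : ∀ {x y} → x < y → x ≤ y
  <⇒≤ = inj₁

  <-≤-trans : ∀ {x y z} → x < y → y ≤ z → x < z
  <-≤-trans x<y (inj₁ y<z)  = <-trans x<y y<z
  <-≤-trans x<y (inj₂ refl) = x<y

  ≤-<-trans : ∀ {x y z} → x ≤ y → y < z → x < z
  ≤-<-trans (inj₁ x<y)  y<z = <-trans x<y y<z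
  ≤-<-trans (inj₂ refl) y<z = y<z

  module ≤-Reasoning = Triple {_≈_ = _≡_} ≤-isPreorder <-asym <-trans (resp₂ _<_) <⇒≤ <-≤-trans ≤-<-trans

  ≤⇒≯ : ∀ {x y} → x ≤ y → ¬ y < x
  ≤⇒≯ x≤y y<x = <-irrefl refl (≤-<-trans x≤y y<x)

  ≮⇒≥ : ∀ {x y} → ¬ x < y → y ≤ x
  ≮⇒≥ {x} {y} x≮y with compare x y
  ... | tri< x<y _ _ = ⊥-elim (x≮y x<y)
  ... | tri≈ _ x≡y _ = inj₂ (sym x≡y)
  ... | tri> _ _ y<x = inj₁ y<x

  ≰⇒> : ∀ {x y} → ¬ x ≤ y → y < x
  ≰⇒> {x} {y} x≰y with compare x y
  ... | tri< x<y _ _ = ⊥-elim (x≰y (inj₁ x<y))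
  ... | tri≈ _ x≡y _ = ⊥-elim (x≰y (inj₂ x≡y))
  ... | tri> _ _ y<x = y<x

  +-monoˡ-≤ : ∀ {x y} z → x ≤ y → x + z ≤ y + z
  +-monoˡ-≤ z (inj₁ x<y)  = inj₁ (+-monoˡ-< _ _ z x<y)
  +-monoˡ-≤ z (inj₂ refl) = inj₂ refl

  +-mono-≤ : ∀ {x y z w} → x ≤ y → z ≤ w → x + z ≤ y + w
  +-mono-≤ {x} {y} {z} {w} x≤y z≤w = begin
    x + z ≤⟨ +-monoˡ-≤ z x≤y ⟩
    y + z ≡⟨ +-comm y z ⟩
    z + y ≤⟨ +-monoˡ-≤ y z≤w ⟩
    w + y ≡⟨ +-comm w y ⟩
    y + w ∎
    where open ≤-Reasoning

  +-cancelʳ : ∀ x z → x + z + - z ≡ x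
  +-cancelʳ x z = trans (+-assoc x z (- z)) (trans (cong (x +_) (-‿inverseʳ z)) (+-identityʳ x))

  -‿+-cancel : ∀ x z → x - z + z ≡ x
  -‿+-cancel x z = trans (+-assoc x (- z) z) (trans (cong (x +_) (-‿inverseˡ z)) (+-identityʳ x))

  +-cancelʳ-≤ : ∀ {x y} z → x + z ≤ y + z → x ≤ y
  +-cancelʳ-≤ {x} {y} z le = begin
    x           ≡⟨ +-cancelʳ x z ⟨
    x + z + - z ≤⟨ +-monoˡ-≤ (- z) le ⟩
    y + z + - z ≡⟨ +-cancelʳ y z ⟩
    y           ∎
    where open ≤-Reasoning

  x≤y⇒0≤y-x : ∀ {x y} → x ≤ y → 0ℝ ≤ y - x
  x≤y⇒0≤y-x {x} {y} x≤y = +-cancelʳ-≤ x (begin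
    0ℝ + x    ≡⟨ +-identityˡ x ⟩
    x         ≤⟨ x≤y ⟩
    y         ≡⟨ -‿+-cancel y x ⟨
    y - x + x ∎)
    where open ≤-Reasoning

  [y-x]+[z-y]≡z-x : ∀ x y z → (y - x) + (z - y) ≡ z - x
  [y-x]+[z-y]≡z-x x y z = begin
    (y - x) + (z - y)   ≡⟨ solve 4 (λ y z a b → (y :+ a) :+ (z :+ b) := (z :+ a) :+ (y :+ b)) refl y z (- x) (- y) ⟩
    (z - x) + (y + - y) ≡⟨ cong (z - x +_) (-‿inverseʳ y) ⟩
    (z - x) + 0ℝ        ≡⟨ +-identityʳ (z - x) ⟩
    z - x               ∎
    where open ≡-Reasoning

  x<x+y : ∀ x {y} → 0ℝ < y → x < x + y
  x<x+y x {y} 0<y = begin-strict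
    x      ≡⟨ +-identityˡ x ⟨
    0ℝ + x <⟨ +-monoˡ-< 0ℝ y x 0<y ⟩
    y + x  ≡⟨ +-comm y x ⟩
    x + y  ∎
    where open ≤-Reasoning

  x≤x+y : ∀ x {y} → 0ℝ ≤ y → x ≤ x + y
  x≤x+y x {y} 0≤y = subst (_≤ x + y) (+-identityʳ x) (+-mono-≤ (≤-refl {x}) 0≤y)

  0≤+ : ∀ {x y} → 0ℝ ≤ x → 0ℝ ≤ y → 0ℝ ≤ x + y
  0≤+ {x} 0≤x 0≤y = ≤-trans 0≤x (x≤x+y x 0≤y)

  0≤* : ∀ {x y} → 0ℝ ≤ x → 0ℝ ≤ y → 0ℝ ≤ x * y
  0≤* {x} {y} (inj₁ 0<x) (inj₁ 0<y) = inj₁ (*-pos x y 0<x 0<y)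
  0≤* {x} {y} (inj₂ refl) _         = inj₂ (sym (zeroˡ y))
  0≤* {x} {y} _ (inj₂ refl)         = inj₂ (sym (zeroʳ x))

  *-monoʳ-≤ : ∀ {x y z} → 0ℝ ≤ z → x ≤ y → z * x ≤ z * y
  *-monoʳ-≤ {x} {y} {z} 0≤z x≤y = begin
    z * x               ≤⟨ x≤x+y (z * x) (0≤* 0≤z (x≤y⇒0≤y-x x≤y)) ⟩
    z * x + z * (y - x) ≡⟨ distribˡ z x (y - x) ⟨
    z * (x + (y - x))   ≡⟨ cong (z *_) (trans (+-comm x (y - x)) (-‿+-cancel y x)) ⟩
    z * y               ∎
    where open ≤-Reasoning

  *-monoˡ-≤ : ∀ {x y z} → 0ℝ ≤ z → x ≤ y → x * z ≤ y * z
  *-monoˡ-≤ {x} {y} {z} 0≤z x≤y = begin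
    x * z ≡⟨ *-comm x z ⟩
    z * x ≤⟨ *-monoʳ-≤ 0≤z x≤y ⟩
    z * y ≡⟨ *-comm z y ⟩
    y * z ∎
    where open ≤-Reasoning

  *-monoˡ-< : ∀ {x y z} → 0ℝ < z → x < y → x * z < y * z
  *-monoˡ-< {x} {y} {z} 0<z x<y = begin-strict
    x * z               <⟨ x<x+y (x * z) (*-pos _ _ 0<y-x 0<z) ⟩
    x * z + (y - x) * z ≡⟨ distribʳ z x (y - x) ⟨
    (x + (y - x)) * z   ≡⟨ cong (_* z) (trans (+-comm x (y - x)) (-‿+-cancel y x)) ⟩
    y * z               ∎
    where
    open ≤-Reasoning
    0<y-x : 0ℝ < y - x
    0<y-x = subst (_< y - x) (-‿inverseʳ x) (+-monoˡ-< x y (- x) x<y)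

  *-cancelˡ-≤ : ∀ {x y} z → 0ℝ < z → z * x ≤ z * y → x ≤ y
  *-cancelˡ-≤ {x} {y} z 0<z zx≤zy = ≮⇒≥ λ y<x → ≤⇒≯ zx≤zy (begin-strict
    z * y ≡⟨ *-comm z y ⟩
    y * z <⟨ *-monoˡ-< 0<z y<x ⟩
    x * z ≡⟨ *-comm x z ⟩
    z * x ∎)
    where open ≤-Reasoning

  0<⇒≢0 : ∀ {x} → 0ℝ < x → x ≢ 0ℝ
  0<⇒≢0 0<x x≡0 = <-irrefl (sym x≡0) 0<x

  0<⇒0<⁻¹ : ∀ {x} → 0ℝ < x → 0ℝ < x ⁻¹
  0<⇒0<⁻¹ {x} 0<x = ≰⇒> λ x⁻¹≤0 → ≤⇒≯ (begin
    1ℝ       ≡⟨ *-inverse x (0<⇒≢0 0<x) ⟨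
    x * x ⁻¹ ≤⟨ *-monoʳ-≤ (<⇒≤ 0<x) x⁻¹≤0 ⟩
    x * 0ℝ   ≡⟨ zeroʳ x ⟩
    0ℝ       ∎) 0<1
    where open ≤-Reasoning

  fromℕ-+ : ∀ m n → fromℕ (m ℕ.+ n) ≡ fromℕ m + fromℕ n
  fromℕ-+ zero    n = sym (+-identityˡ _)
  fromℕ-+ (suc m) n = trans (cong (1ℝ +_) (fromℕ-+ m n)) (sym (+-assoc _ _ _))

  fromℕ-* : ∀ m n → fromℕ (m ℕ.* n) ≡ fromℕ m * fromℕ n
  fromℕ-* zero    n = sym (zeroˡ _)
  fromℕ-* (suc m) n = trans (fromℕ-+ n (m ℕ.* n)) (trans (cong (fromℕ n +_) (fromℕ-* m n))
    (solve 2 (λ m n → n :+ m :* n := (con 1 :+ m) :* n) refl (fromℕ m) (fromℕ n)))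

  0≤fromℕ : ∀ n → 0ℝ ≤ fromℕ n
  0≤fromℕ zero    = ≤-refl
  0≤fromℕ (suc n) = 0≤+ (<⇒≤ 0<1) (0≤fromℕ n)

  0<fromℕ : ∀ n → 0ℝ < fromℕ (suc n)
  0<fromℕ n = <-≤-trans 0<1 (x≤x+y 1ℝ (0≤fromℕ n))

  fromℕ-mono-≤ : ∀ {m n} → m ℕ.≤ n → fromℕ m ≤ fromℕ n
  fromℕ-mono-≤ {n = n} ℕ.z≤n = 0≤fromℕ n
  fromℕ-mono-≤ (ℕ.s≤s m≤n)   = +-mono-≤ (≤-refl {1ℝ}) (fromℕ-mono-≤ m≤n)

  fromℕ-cancel-≤ : ∀ m n → fromℕ m ≤ fromℕ n → m ℕ.≤ n
  fromℕ-cancel-≤ m n le = ℕ.≮⇒≥ λ n<m → ≤⇒≯ le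
    (<-≤-trans (subst (fromℕ n <_) (+-comm (fromℕ n) 1ℝ) (x<x+y (fromℕ n) 0<1)) (fromℕ-mono-≤ n<m))

  abstract
    -- Excluded middle: the supremum of {0} ∪ {1 ∣ P} is positive exactly when P holds.
    em : (P : Set) → Dec P
    em P = decide (supremum S (0ℝ , inj₁ refl) (1ℝ , λ { x (inj₁ refl) → <⇒≤ 0<1 ; x (inj₂ (refl , _)) → ≤-refl }))
      where
      S : ℝ → Set
      S x = x ≡ 0ℝ ⊎ (x ≡ 1ℝ × P)
      decide : ∃[ s ] IsSupremum S s → Dec P
      decide (s , upper , approx) with 0ℝ <? s
      ... | no 0≮s = no λ p → 0≮s (<-≤-trans 0<1 (upper 1ℝ (inj₂ (refl , p))))
      ... | yes 0<s with approx 0ℝ 0<s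
      ... | x , inj₁ refl , 0<0    = ⊥-elim (<-irrefl refl 0<0)
      ... | x , inj₂ (_ , p) , _ = yes p

  -- By contradiction: if all naturals lay below `x`, they would have a supremum `s`; a natural
  -- above `s - 1` exists, and its successor exceeds `s`.
  archimedean : ∀ x → ∃[ n ] x ≤ fromℕ n
  archimedean x with em (∃[ n ] x ≤ fromℕ n)
  ... | yes p  = p
  ... | no  ¬p with supremum (λ y → ∃[ n ] y ≡ fromℕ n) (0ℝ , 0 , refl)
                     (x , λ { y (n , refl) → <⇒≤ (≰⇒> λ x≤n → ¬p (n , x≤n)) })
  ... | s , upper , approx with approx (s - 1ℝ) (begin-strict
      s - 1ℝ      <⟨ x<x+y (s - 1ℝ) 0<1 ⟩
      s - 1ℝ + 1ℝ ≡⟨ -‿+-cancel s 1ℝ ⟩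
      s           ∎)
    where open ≤-Reasoning
  ... | y , (n , refl) , s-1<n = ⊥-elim (≤⇒≯ (upper _ (suc n , refl)) (begin-strict
      s            ≡⟨ -‿+-cancel s 1ℝ ⟨
      s - 1ℝ + 1ℝ  <⟨ +-monoˡ-< _ _ 1ℝ s-1<n ⟩
      fromℕ n + 1ℝ ≡⟨ +-comm (fromℕ n) 1ℝ ⟩
      fromℕ (suc n) ∎))
    where open ≤-Reasoning

  sumOver : ∀ {A : Set} → List A → (A → ℝ) → ℝ
  sumOver xs f = sumℝ (map f xs)

  module _ {A : Set} where

    sumOver-const : ∀ (xs : List A) c → sumOver xs (λ _ → c) ≡ fromℕ (length xs) * c
    sumOver-const []       c = sym (zeroˡ c)
    sumOver-const (x ∷ xs) c = trans (cong (c +_) (sumOver-const xs c))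
      (solve 2 (λ c l → c :+ l :* c := (con 1 :+ l) :* c) refl c (fromℕ (length xs)))

    sumOver-+ : ∀ (xs : List A) f g → sumOver xs (λ x → f x + g x) ≡ sumOver xs f + sumOver xs g
    sumOver-+ []       f g = sym (+-identityˡ 0ℝ)
    sumOver-+ (x ∷ xs) f g = trans (cong (f x + g x +_) (sumOver-+ xs f g))
      (solve 4 (λ a b c d → a :+ b :+ (c :+ d) := a :+ c :+ (b :+ d)) refl (f x) (g x) (sumOver xs f) (sumOver xs g))

    sumOver-mono : ∀ (xs : List A) {f g} → (∀ x → f x ≤ g x) → sumOver xs f ≤ sumOver xs g
    sumOver-mono []       f≤g = ≤-refl
    sumOver-mono (x ∷ xs) f≤g = +-mono-≤ (f≤g x) (sumOver-mono xs f≤g)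

    sumOver-fromℕ : ∀ (xs : List A) f → sumOver xs (λ x → fromℕ (f x)) ≡ fromℕ (∑ xs f)
    sumOver-fromℕ []       f = refl
    sumOver-fromℕ (x ∷ xs) f = trans (cong (fromℕ (f x) +_) (sumOver-fromℕ xs f)) (sym (fromℕ-+ (f x) _))

    -- The first-moment argument: a head below the average `c` can be discarded, since the tail then
    -- still averages at least `c`; the last remaining element must reach it.
    sumOver-≥⇒∃≥ : ∀ (xs : List A) f c → 0ℝ < fromℕ (length xs) → fromℕ
        (length xs) * c ≤ sumOver xs f → ∃[ x ] c ≤ f x
    sumOver-≥⇒∃≥ []           f c 0<0 le = ⊥-elim (<-irrefl refl 0<0)
    sumOver-≥⇒∃≥ (x ∷ xs) f c _ le with c ≤? f x
    ... | yes c≤fx = x , c≤fx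
    ... | no  c≰fx with xs
    ... | []      = x , (begin
      c                      ≡⟨ solve 1 (λ c → c := (con 1 :+ con 0) :* c) refl c ⟩
      fromℕ 1 * c            ≤⟨ le ⟩
      f x + 0ℝ               ≡⟨ +-identityʳ (f x) ⟩
      f x                    ∎)
      where open ≤-Reasoning
    ... | y ∷ ys = sumOver-≥⇒∃≥ (y ∷ ys) f c (0<fromℕ (length ys)) (+-cancelʳ-≤ c (begin
      fromℕ (length (y ∷ ys)) * c + c ≡⟨ solve 2 (λ c l → l :* c :+ c := (con 1 :+ l) :* c) refl c
          (fromℕ (length (y ∷ ys))) ⟩
      fromℕ (length (x ∷ y ∷ ys)) * c ≤⟨ le ⟩
      f x + sumOver (y ∷ ys) f        ≤⟨ +-monoˡ-≤ _ (<⇒≤ (≰⇒> c≰fx)) ⟩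
      c + sumOver (y ∷ ys) f          ≡⟨ +-comm c _ ⟩
      sumOver (y ∷ ys) f + c          ∎))
      where open ≤-Reasoning

    sumOver-cong : ∀ (xs : List A) {f g} → (∀ x → f x ≡ g x) → sumOver xs f ≡ sumOver xs g
    sumOver-cong xs f≡g = cong sumℝ (List.map-cong f≡g xs)

    sumOver-++ : ∀ (xs ys : List A) f → sumOver (xs ++ ys) f ≡ sumOver xs f + sumOver ys f
    sumOver-++ []       ys f = sym (+-identityˡ _)
    sumOver-++ (x ∷ xs) ys f = trans (cong (f x +_) (sumOver-++ xs ys f)) (sym (+-assoc (f x) _ _))

    sumOver-map : ∀ {B : Set} (h : A → B) xs f → sumOver (map h xs) f ≡ sumOver xs (f ∘ h)
    sumOver-map h xs f = cong sumℝ (sym (List.map-∘ xs))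

  sumOver-cartesianProduct : ∀ {A B : Set} (xs : List A) (ys : List B) f →
    sumOver (cartesianProduct xs ys) f ≡ sumOver xs (λ x → sumOver ys (λ y → f (x , y)))
  sumOver-cartesianProduct []       ys f = refl
  sumOver-cartesianProduct (x ∷ xs) ys f = trans (sumOver-++ (map (x ,_) ys) _ f)
    (cong₂ _+_ (sumOver-map (x ,_) ys f) (sumOver-cartesianProduct xs ys f))

-- Events, indicators and simple functions.

module ProbabilityProperties (R : CompleteOrderedField) (Pr : Probability.ProbabilitySpace R) where
  open CompleteOrderedField R
  open OrderedFieldProperties R
  open Probability R
  open ProbabilitySpace Pr

  private
    variable
      E F : Pred Ω 0ℓ

  measurable-∅ : Measurable ∅
  measurable-∅ = measurable-resp (λ ¬⊤ → ¬⊤ _) (λ ()) (measurable-∁ measurable-U)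

  measurable-∪ : Measurable E → Measurable F → Measurable (E ∪ F)
  measurable-∪ {E} {F} mE mF = measurable-resp
    (λ { (zero , e) → inj₁ e ; (suc _ , f) → inj₂ f })
    (λ { (inj₁ e) → 0 , e ; (inj₂ f) → 1 , f })
    (measurable-⋃ E∣F λ { zero → mE ; (suc _) → mF })
    where
    E∣F : ℕ → Pred Ω 0ℓ
    E∣F zero    = E
    E∣F (suc _) = F

  measurable-∩ : Measurable E → Measurable F → Measurable (E ∩ F)
  measurable-∩ {E} {F} mE mF = measurable-resp deMorgan (λ { (e , f) (inj₁ ¬e) → ¬e e ; (e , f) (inj₂ ¬f) → ¬f f })
    (measurable-∁ (measurable-∪ (measurable-∁ mE) (measurable-∁ mF)))
    where
    deMorgan : ∁ (∁ E ∪ ∁ F) ⊆ᵉ E ∩ F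
    deMorgan {ω} ¬∪ with em (E ω) | em (F ω)
    ... | yes e | yes f = e , f
    ... | no ¬e | _     = ⊥-elim (¬∪ (inj₁ ¬e))
    ... | _     | no ¬f = ⊥-elim (¬∪ (inj₂ ¬f))

  -- Countable additivity for the constant sequence of empty sets: already its second partial sum,
  -- twice `ℙ ∅`, is at most `ℙ ∅`.
  ℙ-∅ : ℙ ∅ ≡ 0ℝ
  ℙ-∅ = ≤-antisym (+-cancelʳ-≤ (ℙ ∅) (begin
    ℙ ∅ + ℙ ∅            ≡⟨ cong (_+ ℙ ∅) (+-identityˡ (ℙ ∅)) ⟨
    0ℝ + ℙ ∅ + ℙ ∅       ≤⟨ proj₁ (ℙ-⋃ (λ _ → ∅) (λ _ → measurable-∅) (λ _ _ _ _ ())) _ (2 , refl) ⟩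
    ℙ (⋃ ℕ (λ _ → ∅))    ≡⟨ ℙ-resp (λ { (_ , ()) }) (λ ()) (measurable-⋃ (λ _ → ∅) (λ _ → measurable-∅)) ⟩
    ℙ ∅                  ≡⟨ +-identityˡ (ℙ ∅) ⟨
    0ℝ + ℙ ∅             ∎)) (ℙ-nonneg measurable-∅)
    where open ≤-Reasoning

  ℙ-empty : Measurable F → (∀ ω → ¬ F ω) → ℙ F ≡ 0ℝ
  ℙ-empty mF ¬F = trans (ℙ-resp (λ {ω} f → ¬F ω f) (λ ()) mF) ℙ-∅

  -- Finite additivity is extracted from the countable one by padding the two parts with empty sets;
  -- the partial sums are constant from the second on, so the supremum is their value. `em` shows
  -- that the two parts cover `F`.
  ℙ-split : Measurable F → Measurable E → ℙ F ≡ ℙ (F ∩ E) + ℙ (F ∩ ∁ E)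
  ℙ-split {F} {E} mF mE = trans (ℙ-resp cover (λ { (0 , f , _) → f ; (1 , f , _) → f }) mF)
    (≤-antisym (≮⇒≥ λ sum<⋃ → exceeds (proj₂ isSup _ sum<⋃)) (begin
      ℙ (F ∩ E) + ℙ (F ∩ ∁ E)        ≡⟨ cong (_+ ℙ (F ∩ ∁ E)) (+-identityˡ (ℙ (F ∩ E))) ⟨
      0ℝ + ℙ (F ∩ E) + ℙ (F ∩ ∁ E)   ≤⟨ proj₁ isSup _ (2 , refl) ⟩
      ℙ (⋃ ℕ parts)                  ∎))
    where
    open ≤-Reasoning
    parts : ℕ → Pred Ω 0ℓ
    parts 0             = F ∩ E
    parts 1             = F ∩ ∁ E
    parts (suc (suc _)) = ∅
    m∩ = measurable-∩ mF mE
    m∖ = measurable-∩ mF (measurable-∁ mE)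
    m-parts : ∀ n → Measurable (parts n)
    m-parts 0             = m∩
    m-parts 1             = m∖
    m-parts (suc (suc _)) = measurable-∅
    disjoint : ∀ m n → m ≢ n → Empty (parts m ∩ parts n)
    disjoint 0 0 m≢n _ _                                 = m≢n refl
    disjoint 0 1 _   _ ((_ , e) , (_ , ¬e))              = ¬e e
    disjoint 1 0 _   _ ((_ , ¬e) , (_ , e))              = ¬e e
    disjoint 1 1 m≢n _ _                                 = m≢n refl
    disjoint 0 (suc (suc _)) _ _ (_ , ())
    disjoint 1 (suc (suc _)) _ _ (_ , ())
    disjoint (suc (suc _)) _ _ _ (() , _)
    isSup = ℙ-⋃ parts m-parts disjoint
    cover : F ⊆ᵉ ⋃ ℕ parts
    cover {ω} f with em (E ω)
    ... | yes e = 0 , f , e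
    ... | no ¬e = 1 , f , ¬e
    partial≤ : ∀ n → partialSum (λ m → ℙ (parts m)) n ≤ ℙ (F ∩ E) + ℙ (F ∩ ∁ E)
    partial≤ 0                   = 0≤+ (ℙ-nonneg m∩) (ℙ-nonneg m∖)
    partial≤ 1                   = begin
      0ℝ + ℙ (F ∩ E)          ≡⟨ +-identityˡ _ ⟩
      ℙ (F ∩ E)               ≤⟨ x≤x+y _ (ℙ-nonneg m∖) ⟩
      ℙ (F ∩ E) + ℙ (F ∩ ∁ E) ∎
    partial≤ 2                   = ≤-reflexive (cong (_+ ℙ (F ∩ ∁ E)) (+-identityˡ _))
    partial≤ (suc (suc (suc n))) = begin
      partialSum (λ m → ℙ (parts m)) (suc (suc n)) + ℙ ∅ ≡⟨ trans
          (cong (partialSum (λ m → ℙ (parts m)) (suc (suc n)) +_) ℙ-∅) (+-identityʳ _) ⟩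
      partialSum (λ m → ℙ (parts m)) (suc (suc n))       ≤⟨ partial≤ (suc (suc n)) ⟩
      ℙ (F ∩ E) + ℙ (F ∩ ∁ E)                            ∎
    exceeds : ¬ (∃[ x ] (∃[ n ] x ≡ partialSum (λ m → ℙ (parts m)) n) × ℙ (F ∩ E) + ℙ (F ∩ ∁ E) < x)
    exceeds (_ , (n , refl) , lt) = ≤⇒≯ (partial≤ n) lt

  indicator : ∀ {P : Set} → Dec P → ℝ
  indicator (yes _) = 1ℝ
  indicator (no  _) = 0ℝ

  indicator-nonneg : ∀ {P : Set} (d : Dec P) → 0ℝ ≤ indicator d
  indicator-nonneg (yes _) = <⇒≤ 0<1
  indicator-nonneg (no  _) = ≤-refl

  indicator-true : ∀ {P : Set} (d : Dec P) → P → indicator d ≡ 1ℝ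
  indicator-true (yes _) _ = refl
  indicator-true (no ¬p) p = ⊥-elim (¬p p)

  -- Only an inequality, because nothing is assumed about the events from `k` on; their indicators
  -- are just nonnegative.
  ≤sumOver-indicator : ∀ n k (E : ℕ → Set) → k ℕ.≤ n → (∀ d → d ℕ.< k → E d) →
    fromℕ k ≤ sumOver (downFrom n) (λ d → indicator (em (E d)))
  ≤sumOver-indicator zero    zero E _    _   = ≤-refl
  ≤sumOver-indicator (suc n) k    E k≤1+n holds with ℕ.m≤n⇒m<n∨m≡n k≤1+n
  ... | inj₁ (ℕ.s≤s k≤n) = ≤-trans (≤sumOver-indicator n k E k≤n holds)
    (subst (_≤ indicator (em (E n)) + rest) (+-identityˡ rest) (+-monoˡ-≤ rest (indicator-nonneg (em (E n)))))
    where rest = sumOver (downFrom n) (λ d → indicator (em (E d)))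
  ... | inj₂ refl = +-mono-≤ (≤-reflexive (sym (indicator-true (em (E n)) (holds n ℕ.≤-refl))))
    (≤sumOver-indicator n n E ℕ.≤-refl (λ d d<n → holds d (ℕ.m≤n⇒m≤1+n d<n)))

  module _ {A : Set} (w : A → ℝ) (E : A → Pred Ω 0ℓ) (mE : ∀ x → Measurable (E x)) where

    -- Monotonicity and linearity of the integral, for combinations of indicators.
    *ℙ≤sumOver : ∀ xs (F : Pred Ω 0ℓ) κ → Measurable F →
      (∀ ω → F ω → κ ≤ sumOver xs (λ x → w x * indicator (em (E x ω)))) →
      κ * ℙ F ≤ sumOver xs (λ x → w x * ℙ (F ∩ E x))
    -- With no summand left, the hypothesis says `κ ≤ 0` wherever `F` holds, so a positive `κ`
    -- forces `F` to be empty.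
    *ℙ≤sumOver [] F κ mF κ≤ with κ ≤? 0ℝ
    ... | yes κ≤0 = begin
      κ * ℙ F  ≤⟨ *-monoˡ-≤ (ℙ-nonneg mF) κ≤0 ⟩
      0ℝ * ℙ F ≡⟨ zeroˡ _ ⟩
      0ℝ       ∎
      where open ≤-Reasoning
    ... | no κ≰0 = ≤-reflexive (trans (cong (κ *_) (ℙ-empty mF λ ω f → κ≰0 (κ≤ ω f))) (zeroʳ κ))
    -- Split `F` along `E x`: inside, the first summand equals `w x` and `κ - w x` is left for the
    -- tail; outside, it vanishes. The induction therefore has to admit every `F` and every sign of
    -- `κ`.
    *ℙ≤sumOver (x ∷ xs) F κ mF κ≤ = begin
      κ * ℙ F
        ≡⟨ cong (κ *_) (ℙ-split mF (mE x)) ⟩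
      κ * (ℙ F∩ + ℙ F∖)
        ≡⟨ trans (distribˡ κ _ _) (cong (λ k → k * ℙ F∩ + κ * ℙ F∖) (sym (-‿+-cancel κ (w x)))) ⟩
      (κ - w x + w x) * ℙ F∩ + κ * ℙ F∖
        ≡⟨ solve 5 (λ d w p k n → (d :+ w) :* p :+ k :* n := w :* p :+ (d :* p :+ k :* n)) refl (κ - w x)
            (w x) (ℙ F∩) κ (ℙ F∖) ⟩
      w x * ℙ F∩ + ((κ - w x) * ℙ F∩ + κ * ℙ F∖)
        ≤⟨ +-mono-≤ (≤-refl {w x * ℙ F∩})
            (+-mono-≤ (*ℙ≤sumOver xs F∩ (κ - w x) m∩ inside) (*ℙ≤sumOver xs F∖ κ m∖ outside)) ⟩
      w x * ℙ F∩ + (sumOver xs (λ y → w y * ℙ (F∩ ∩ E y)) + sumOver xs (λ y → w y * ℙ (F∖ ∩ E y)))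
        ≡⟨ cong (w x * ℙ F∩ +_) (sumOver-+ xs _ _) ⟨
      w x * ℙ F∩ + sumOver xs (λ y → w y * ℙ (F∩ ∩ E y) + w y * ℙ (F∖ ∩ E y))
        ≤⟨ +-mono-≤ (≤-refl {w x * ℙ F∩}) (sumOver-mono xs (λ y → ≤-reflexive (rejoin y))) ⟩
      w x * ℙ F∩ + sumOver xs (λ y → w y * ℙ (F ∩ E y)) ∎
      where
      open ≤-Reasoning
      F∩ = F ∩ E x
      F∖ = F ∩ ∁ (E x)
      m∩ = measurable-∩ mF (mE x)
      m∖ = measurable-∩ mF (measurable-∁ (mE x))
      rest = λ ω → sumOver xs (λ y → w y * indicator (em (E y ω)))
      inside : ∀ ω → F∩ ω → κ - w x ≤ rest ω
      inside ω (f , e) with em (E x ω) | κ≤ ω f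
      ... | no ¬e | _  = ⊥-elim (¬e e)
      ... | yes _ | le = +-cancelʳ-≤ (w x) (begin
        κ - w x + w x ≡⟨ -‿+-cancel κ (w x) ⟩
        κ             ≤⟨ le ⟩
        w x * 1ℝ + rest ω ≡⟨ trans (+-comm _ _) (cong (rest ω +_) (*-identityʳ (w x))) ⟩
        rest ω + w x ∎)
      outside : ∀ ω → F∖ ω → κ ≤ rest ω
      outside ω (f , ¬e) with em (E x ω) | κ≤ ω f
      ... | yes e | _  = ⊥-elim (¬e e)
      ... | no _  | le = ≤-trans le (≤-reflexive (trans (cong (_+ rest ω) (zeroʳ (w x))) (+-identityˡ _)))
      rejoin : ∀ y → w y * ℙ (F∩ ∩ E y) + w y * ℙ (F∖ ∩ E y) ≡ w y * ℙ (F ∩ E y)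
      rejoin y = trans (sym (distribˡ (w y) _ _)) (cong (w y *_) (trans
        (cong₂ _+_
          (ℙ-resp (λ { ((f , e) , e′) → (f , e′) , e }) (λ { ((f , e′) , e) → (f , e) , e′ })
              (measurable-∩ m∩ (mE y)))
          (ℙ-resp (λ { ((f , e) , e′) → (f , e′) , e }) (λ { ((f , e′) , e) → (f , e) , e′ })
              (measurable-∩ m∖ (mE y))))
        (sym (ℙ-split (measurable-∩ mF (mE y)) (mE x)))))

    ≤sumOver-ℙ : ∀ xs κ → (∀ ω → κ ≤ sumOver xs (λ x → w x * indicator (em (E x ω)))) →
      κ ≤ sumOver xs (λ x → w x * ℙ (E x))
    ≤sumOver-ℙ xs κ κ≤ = begin
      κ                                   ≡⟨ *-identityʳ κ ⟨
      κ * 1ℝ                              ≡⟨ cong (κ *_) ℙ-U ⟨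
      κ * ℙ U                             ≤⟨ *ℙ≤sumOver xs U κ measurable-U (λ ω _ → κ≤ ω) ⟩
      sumOver xs (λ x → w x * ℙ (U ∩ E x)) ≤⟨ sumOver-mono xs
          (λ x → ≤-reflexive (cong (w x *_) (ℙ-resp proj₂ (_ ,_) (measurable-∩ measurable-U (mE x))))) ⟩
      sumOver xs (λ x → w x * ℙ (E x))    ∎
      where open ≤-Reasoning

  -- The single term `q` on the event `q < X` is itself a simple function below `X`.
  markov : ∀ {X q c} → MeasurableFunction X → 0ℝ ≤ q → 𝔼[ X ]≤ c → q * ℙ (λ ω → q < X ω) ≤ c
  markov {X} {q} {c} mX 0≤q X≤c = subst (_≤ c) (+-identityʳ _) (X≤c record
    { terms      = (q , λ ω → q < X ω) ∷ []
    ; measurable = mX q ∷ []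
    ; disjoint   = [] ∷ []
    ; nonneg     = 0≤q ∷ []
    ; below      = (λ _ → <⇒≤) ∷ []
    })

  module LayerCake {X : Ω → ℝ} (mX : MeasurableFunction X) {θ : ℝ} (0≤θ : 0ℝ ≤ θ) where

    level : ℕ → Pred Ω 0ℓ
    level n ω = θ * fromℕ n < X ω

    private
      level-anti : ∀ n → level (suc n) ⊆ᵉ level n
      level-anti n = ≤-<-trans (*-monoʳ-≤ 0≤θ (fromℕ-mono-≤ (ℕ.n≤1+n n)))

      slice : ℕ → Pred Ω 0ℓ
      slice n = level n ∩ ∁ (level (suc n))

      slices : ℕ → List (ℝ × Pred Ω 0ℓ)
      slices zero    = []
      slices (suc n) = (θ * fromℕ n , slice n) ∷ slices n

      slices-measurable : ∀ n → All (λ (c , E) → Measurable E) (slices n)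
      slices-measurable zero    = []
      slices-measurable (suc n) = measurable-∩ (mX _) (measurable-∁ (mX _)) ∷ slices-measurable n

      slices-nonneg : ∀ n → All (λ (c , E) → 0ℝ ≤ c) (slices n)
      slices-nonneg zero    = []
      slices-nonneg (suc n) = 0≤* 0≤θ (0≤fromℕ n) ∷ slices-nonneg n

      slices-below : ∀ n → All (λ (c , E) → ∀ ω → E ω → c ≤ X ω) (slices n)
      slices-below zero    = []
      slices-below (suc n) = (λ ω (l , _) → <⇒≤ l) ∷ slices-below n

      level-slices : ∀ n → All (λ (c , E) → Empty (level n ∩ E)) (slices n)
      level-slices zero    = []
      level-slices (suc n) = (λ _ (l , _ , ¬l) → ¬l l) ∷ All.map (λ e ω (l , x) → e ω (level-anti n l , x))
          (level-slices n)

      slices-disjoint : ∀ n → AllPairs (λ (c , E) (d , F) → Empty (E ∩ F)) (slices n)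
      slices-disjoint zero    = []
      slices-disjoint (suc n) = All.map (λ e ω ((l , _) , x) → e ω (l , x)) (level-slices n) ∷ slices-disjoint n

    -- The value is `θ` times the highest level reached, capped at `n`. The nested levels are cut
    -- into slices because the terms of a simple function must be disjoint; `level n` is the uncut
    -- top.
    layered : ℕ → SimpleBelow X
    layered n = record
      { terms      = (θ * fromℕ n , level n) ∷ slices n
      ; measurable = mX _ ∷ slices-measurable n
      ; disjoint   = level-slices n ∷ slices-disjoint n
      ; nonneg     = 0≤* 0≤θ (0≤fromℕ n) ∷ slices-nonneg n
      ; below      = (λ _ → <⇒≤) ∷ slices-below n
      }

    -- Summation by parts: passing from `n` to `suc n` splits `level n` into `level (suc n)` and a
    -- slice, and only the former gains a further `θ`.
    integral-layered : ∀ n → SimpleBelow.integral (layered n) ≡ θ * sumOver (downFrom n) (λ d → ℙ (level (suc d)))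
    integral-layered zero    = solve 2 (λ t p → t :* con 0 :* p :+ con 0 := t :* con 0) refl θ (ℙ (level 0))
    integral-layered (suc n) = begin
      θ * (1ℝ + N) * top + (θ * N * ℙ (slice n) + I)
        ≡⟨ solve 5 (λ t n p s i → t :* (con 1 :+ n) :* p :+ (t :* n :* s :+ i) := t :* p :+
            (t :* n :* (p :+ s) :+ i)) refl θ N top (ℙ (slice n)) I ⟩
      θ * top + (θ * N * (top + ℙ (slice n)) + I)
        ≡⟨ cong (λ p → θ * top + (θ * N * p + I))
            (trans (cong (_+ ℙ (slice n)) (ℙ-resp (λ l → level-anti n l , l) proj₂ (mX _)))
            (sym (ℙ-split (mX _) (mX _)))) ⟩
      θ * top + (θ * N * ℙ (level n) + I)
        ≡⟨ cong (θ * top +_) (integral-layered n) ⟩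
      θ * top + θ * sumOver (downFrom n) (λ d → ℙ (level (suc d)))
        ≡⟨ distribˡ θ _ _ ⟨
      θ * sumOver (downFrom (suc n)) (λ d → ℙ (level (suc d))) ∎
      where
      open ≡-Reasoning
      N   = fromℕ n
      top = ℙ (level (suc n))
      I   = sumℝ (map (λ (c , E) → c * ℙ E) (slices n))

    layered⇒𝔼> : ∀ n {c} → c < θ * sumOver (downFrom n) (λ d → ℙ (level (suc d))) → 𝔼[ X ]> c
    layered⇒𝔼> n c< = layered n , subst (_ <_) (sym (integral-layered n)) c<

module LowerBound (R : CompleteOrderedField) where
  open CompleteOrderedField R
  open OrderedFieldProperties R
  open DynamicBinPacking R

  -- Runs on equal items that all arrive at time 0.

  module Batch (n : ℕ) (σ : ℝ) (0≤σ : 0ℝ ≤ σ) (σ≤1 : σ ≤ 1ℝ) where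

    -- Placed before the durations are introduced: the history at the end of the arrivals depends on
    -- `n` and `σ` only, which is what non-clairvoyance means here.
    arrivedAll : List Observation
    arrivedAll = foldl (λ h _ → arrived 0ℝ σ ∷ h) [] (allFin n)

    module _ (dur : Fin n → ℝ) (0<dur : ∀ i → 0ℝ < dur i) where

      batch : Instance
      batch = record
        { n      = n
        ; item   = λ i → record
          { arrival = 0ℝ ; size = σ ; duration = dur i
          ; arrival-nonneg = ≤-refl ; size-nonneg = 0≤σ ; size≤1 = σ≤1 ; duration-pos = 0<dur i
          }
        ; sorted = λ _ _ _ → ≤-refl
        }

      open Execution batch
      open Frame
      open InsertionSort (On.decTotalOrder ≤-decTotalOrder eventTime)
      open InsertionSortProperties (On.decTotalOrder ≤-decTotalOrder eventTime) using (sort-↭; sort-↗)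

      TimeOrdered : List Frame → Set
      TimeOrdered = Linked (λ f g → time f ≤ time g)

      activeTime-nonneg : ∀ fs → TimeOrdered fs → 0ℝ ≤ activeTime fs
      activeTime-nonneg []           _           = ≤-refl
      activeTime-nonneg (f ∷ [])     _           = ≤-refl
      activeTime-nonneg (f ∷ g ∷ fs) (f≤g ∷ ord) =
        0≤+ (0≤* (x≤y⇒0≤y-x f≤g) (0≤fromℕ (nonemptyBins f))) (activeTime-nonneg (g ∷ fs) ord)

      migrated-nonneg : ∀ f g → 0ℝ ≤ sumOver (migratedItems f g) (λ _ → σ)
      migrated-nonneg f g = subst (0ℝ ≤_) (sym (sumOver-const (migratedItems f g) σ))
          (0≤* (0≤fromℕ (length (migratedItems f g))) 0≤σ)

      migrations-nonneg : ∀ fs → 0ℝ ≤ migrations fs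
      migrations-nonneg []           = ≤-refl
      migrations-nonneg (f ∷ [])     = ≤-refl
      migrations-nonneg (f ∷ g ∷ fs) = 0≤+ (migrated-nonneg f g) (migrations-nonneg (g ∷ fs))

      activeTime-∷ : ∀ f g fs → time f ≤ time g → activeTime (g ∷ fs) ≤ activeTime (f ∷ g ∷ fs)
      activeTime-∷ f g fs f≤g = subst (activeTime (g ∷ fs) ≤_) (+-comm (activeTime (g ∷ fs)) _)
        (x≤x+y (activeTime (g ∷ fs)) (0≤* (x≤y⇒0≤y-x f≤g) (0≤fromℕ (nonemptyBins f))))

      migrations-∷ : ∀ f g fs → migrations (g ∷ fs) ≤ migrations (f ∷ g ∷ fs)
      migrations-∷ f g fs = subst (migrations (g ∷ fs) ≤_) (+-comm (migrations (g ∷ fs)) _)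
        (x≤x+y (migrations (g ∷ fs)) (migrated-nonneg f g))

      -- runFrom from just after the observation that completed h; its first frame is in force at time t.
      continue : Algorithm → List Observation → List (Fin n) → ℝ → List Event → List Frame
      continue A h p t es =
        frame t p (Reaction.now (A h)) ∷ framesUntilNext t p (Reaction.later (A h)) es ++ runFrom A h p es

      -- `delayedFrames` can stop after any of its delays, so the frames `gs` that follow must be
      -- known to continue an arbitrary frame not later than `next`.
      delayed-ordered : ∀ ds f next p gs → time f ≤ next → (∀ f′ → time f′ ≤ next → TimeOrdered (f′ ∷ gs)) →
        TimeOrdered (f ∷ delayedFrames (time f) next p ds ++ gs)
      delayed-ordered []       f next p gs f≤next ord = ord f f≤next
      delayed-ordered (d ∷ ds) f next p gs f≤next ord with time f + Delayed.wait d <? next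
      ... | yes lt = <⇒≤ (x<x+y (time f) (Delayed.wait-pos d)) ∷ delayed-ordered ds
          (frame _ p (Delayed.bins d)) next p gs (<⇒≤ lt) ord
      ... | no  _  = ord f f≤next

      continue-ordered : ∀ A h p t es → Linked _≤_ (t ∷ map eventTime es) → TimeOrdered (continue A h p t es)
      continue-ordered A h p t []       _           = [-]
      continue-ordered A h p t (e ∷ es) (t≤e ∷ ord) =
        delayed-ordered (Reaction.later (A h)) _ (eventTime e) p _ t≤e
          λ f f≤e → f≤e ∷ continue-ordered A (observe e ∷ h) (update e p) (eventTime e) es ord

      continue-reaches : ∀ A h p t es {e} → e ∈ es → Any (λ f → time f ≡ eventTime e) (continue A h p t es)
      continue-reaches A h p t (e ∷ es) (here refl) =
        there (Any.++⁺ʳ (delayedFrames t (eventTime e) p (Reaction.later (A h))) (here refl))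
      continue-reaches A h p t (e ∷ es) (there e∈) =
        there (Any.++⁺ʳ (delayedFrames t (eventTime e) p (Reaction.later (A h)))
          (continue-reaches A (observe e ∷ h) (update e p) (eventTime e) es e∈))

      departures : List Event
      departures = sort (map depart (allFin n))

      0<end : ∀ i → 0ℝ < eventTime (depart i)
      0<end i = subst (0ℝ <_) (sym (+-identityˡ (dur i))) (0<dur i)

      sort-arrivals : ∀ is → sort (map arrive is) ≡ map arrive is
      sort-arrivals []           = refl
      sort-arrivals (i ∷ [])     = refl
      sort-arrivals (i ∷ j ∷ is) rewrite sort-arrivals (j ∷ is) with 0ℝ ≤? 0ℝ
      ... | yes _  = refl
      ... | no 0≰0 = ⊥-elim (0≰0 ≤-refl)

      -- In the unsorted list departures precede arrivals. Durations are positive, so insertion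
      -- carries each departure past all arrivals at time 0.
      insert-departure : ∀ i js es → insert (depart i) (map arrive js ++ es) ≡ map arrive js ++ insert (depart i) es
      insert-departure i []       es = refl
      insert-departure i (j ∷ js) es with eventTime (depart i) ≤? 0ℝ
      ... | yes e≤0 = ⊥-elim (≤⇒≯ e≤0 (0<end i))
      ... | no  _   = cong (arrive j ∷_) (insert-departure i js es)

      sort-departures-arrivals : ∀ is js → sort (map depart is ++ map arrive js) ≡ map arrive js ++ sort
          (map depart is)
      sort-departures-arrivals []       js = trans (sort-arrivals js) (sym (List.++-identityʳ _))
      sort-departures-arrivals (i ∷ is) js = trans
          (cong (insert (depart i)) (sort-departures-arrivals is js)) (insert-departure i js _)

      departures-depart : All (λ e → ∃[ i ] e ≡ depart i) departures
      departures-depart = All-resp-↭ (↭-sym (sort-↭ (map depart (allFin n))))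
          (All.map⁺ (All.tabulate λ {i} _ → i , refl))

      ∈-departures : ∀ i → depart i ∈ departures
      ∈-departures i = ∈-resp-↭ (↭-sym (sort-↭ (map depart (allFin n)))) (∈-map⁺ depart (∈-allFin i))

      departures-ordered : Linked _≤_ (0ℝ ∷ map eventTime departures)
      departures-ordered = prepend departures departures-depart (Linked.map⁺ (sort-↗ (map depart (allFin n))))
        where
        prepend : ∀ es → All (λ e → ∃[ i ] e ≡ depart i) es → Linked _≤_ (map eventTime es) → Linked _≤_
            (0ℝ ∷ map eventTime es)
        prepend []       _                ord = [-]
        prepend (e ∷ es) ((i , refl) ∷ _) ord = <⇒≤ (0<end i) ∷ ord

      -- Frames between simultaneous arrivals last no time but may involve migration. Dropping them
      -- therefore gives lower bounds on both quantities, and lower bounds suffice.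
      ArrivalsSkipped : List Frame → List Frame → Set
      ArrivalsSkipped fs gs = activeTime gs ≤ activeTime fs × migrations gs ≤ migrations fs ×
          (All Feasible fs → All Feasible gs)

      -- Waits are strictly positive, so no delayed reassignment fits between two events at the same
      -- time.
      delayedFrames-simultaneous : ∀ ds t p → delayedFrames t t p ds ≡ []
      delayedFrames-simultaneous []       t p = refl
      delayedFrames-simultaneous (d ∷ ds) t p with t + Delayed.wait d <? t
      ... | yes lt = ⊥-elim (≤⇒≯ (<⇒≤ (x<x+y t (Delayed.wait-pos d))) lt)
      ... | no  _  = refl

      skip-arrivals : ∀ A h p is es → ArrivalsSkipped
        (continue A h p 0ℝ (map arrive is ++ es))
        (continue A (foldl (λ h _ → arrived 0ℝ σ ∷ h) h is) (is ʳ++ p) 0ℝ es)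
      skip-arrivals A h p []       es = ≤-refl , ≤-refl , id
      skip-arrivals A h p (i ∷ is) es
        rewrite delayedFrames-simultaneous (Reaction.later (A h)) 0ℝ p
        with skip-arrivals A (arrived 0ℝ σ ∷ h) (i ∷ p) is es
      ... | act , mig , feas =
          ≤-trans act (activeTime-∷ (frame 0ℝ p (Reaction.now (A h))) next rest ≤-refl)
        , ≤-trans mig (migrations-∷ (frame 0ℝ p (Reaction.now (A h))) next rest)
        , λ { (_ ∷ fs) → feas fs }
        where
        h′   = arrived 0ℝ σ ∷ h
        next = frame 0ℝ (i ∷ p) (Reaction.now (A h′))
        rest = framesUntilNext 0ℝ (i ∷ p) (Reaction.later (A h′)) (map arrive is ++ es) ++ runFrom A h′
            (i ∷ p) (map arrive is ++ es)

      -- The run from the last arrival on. Its items are listed in reverse, because `update` puts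
      -- each arrival in front.
      settled : Algorithm → List Frame
      settled A = continue A arrivedAll (allFin n ʳ++ []) 0ℝ departures

      -- The argument of type `Fin n` guarantees a first arrival: `run` opens with the frame of its
      -- first event, and from there on it has the shape of `continue`.
      run-settled : ∀ A → Fin n → ArrivalsSkipped (run A) (settled A)
      run-settled A i₀ = subst (λ es → ArrivalsSkipped (runFrom A [] [] es) (settled A))
        (sym (sort-departures-arrivals (allFin n) (allFin n))) (go (allFin n) (∈-allFin i₀))
        where
        go : ∀ is → i₀ ∈ is → ArrivalsSkipped (runFrom A [] [] (map arrive is ++ departures))
          (continue A (foldl (λ h _ → arrived 0ℝ σ ∷ h) [] is) (is ʳ++ []) 0ℝ departures)
        go (i ∷ is) _ = skip-arrivals A (arrived 0ℝ σ ∷ []) (i ∷ []) is departures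

      -- Bins hold exactly `K` items: feasibility and the optimum.

      module Capacity (K : ℕ) (Kσ≡1 : fromℕ K * σ ≡ 1ℝ) where

        K*sizes≡length : ∀ (is : List (Fin n)) → fromℕ K * sumOver is (λ _ → σ) ≡ fromℕ (length is)
        K*sizes≡length is = begin
          fromℕ K * sumOver is (λ _ → σ)    ≡⟨ cong (fromℕ K *_) (sumOver-const is σ) ⟩
          fromℕ K * (fromℕ (length is) * σ) ≡⟨ solve 3 (λ k l s → k :* (l :* s) := l :* (k :* s)) refl
              (fromℕ K) (fromℕ (length is)) σ ⟩
          fromℕ (length is) * (fromℕ K * σ) ≡⟨ cong (fromℕ (length is) *_) Kσ≡1 ⟩
          fromℕ (length is) * 1ℝ            ≡⟨ *-identityʳ _ ⟩
          fromℕ (length is)                 ∎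
          where open ≡-Reasoning

        sizes≤1⇒length≤K : ∀ (is : List (Fin n)) → sumOver is (λ _ → σ) ≤ 1ℝ → length is ℕ.≤ K
        sizes≤1⇒length≤K is le = fromℕ-cancel-≤ (length is) K (begin
          fromℕ (length is)              ≡⟨ K*sizes≡length is ⟨
          fromℕ K * sumOver is (λ _ → σ) ≤⟨ *-monoʳ-≤ (0≤fromℕ K) le ⟩
          fromℕ K * 1ℝ                   ≡⟨ *-identityʳ _ ⟩
          fromℕ K                        ∎)
          where open ≤-Reasoning

        length≤K⇒sizes≤1 : ∀ (is : List (Fin n)) → length is ℕ.≤ K → sumOver is (λ _ → σ) ≤ 1ℝ
        length≤K⇒sizes≤1 is le = begin
          sumOver is (λ _ → σ)  ≡⟨ sumOver-const is σ ⟩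
          fromℕ (length is) * σ ≤⟨ *-monoˡ-≤ 0≤σ (fromℕ-mono-≤ le) ⟩
          fromℕ K * σ           ≡⟨ Kσ≡1 ⟩
          1ℝ                    ∎
          where open ≤-Reasoning

        settled-capacity : ∀ A → Fin n → All Feasible (run A) → ∀ b →
          length (filter (λ i → Reaction.now (A arrivedAll) (toℕ i) ℕ.≟ b) (allFin n)) ℕ.≤ K
        settled-capacity A i₀ feasible b = ℕ.≤-trans
          (unique-⊆⇒length-≤ (Unique.filter⁺ inBin? (Unique.allFin⁺ n)) λ i∈ →
            let i∈all , i∈b = ∈-filter⁻ inBin? i∈ in ∈-filter⁺ inBin?
                (Any.reverseAcc⁺ [] (allFin n) (inj₂ i∈all)) i∈b)
          (sizes≤1⇒length≤K (filter inBin? (allFin n ʳ++ []))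
              (All.head (proj₂ (proj₂ (run-settled A i₀)) feasible) b))
          where
          inBin? : ∀ i → Dec (Reaction.now (A arrivedAll) (toℕ i) ≡ b)
          inBin? i = Reaction.now (A arrivedAll) (toℕ i) ℕ.≟ b

        open Optimum batch

        present? : ∀ t i → Dec (0ℝ ≤ t × t < 0ℝ + dur i)
        present? t i = (0ℝ ≤? t) ×-dec (t <? 0ℝ + dur i)

        -- Blocks of `K` consecutive values of `idx` give a packing into `k` bins, and the volume
        -- bound excludes fewer, as exactly `k * K` items are present. `idx` need only separate
        -- present items, so the survivors can be numbered by their groups.
        isMinBins : .{{_ : ℕ.NonZero K}} → ∀ t k (idx : Fin n → ℕ) →
          (∀ {i j} → 0ℝ ≤ t × t < 0ℝ + dur i → 0ℝ ≤ t × t < 0ℝ + dur j → idx i ≡ idx j → i ≡ j) →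
          (∀ {i} → 0ℝ ≤ t × t < 0ℝ + dur i → idx i ℕ.< k ℕ.* K) →
          length (presentAt t) ≡ k ℕ.* K → IsMinBins t k
        isMinBins t k idx inj bound len = ((λ i → idx i ℕ./ K) , inRange , fits) , minimal
          where
          inRange : All (λ i → idx i ℕ./ K ℕ.< k) (presentAt t)
          inRange = All.tabulate λ i∈ → m<n*o⇒m/o<n (bound (proj₂ (∈-filter⁻ (present? t) {xs = allFin n} i∈)))
          idx! : Unique (map idx (presentAt t))
          idx! = unique-map-filter (present? t) toℕ idx (λ pi pj → cong toℕ ∘ inj pi pj) (allFin n)
            (Unique.map⁺ Fin.toℕ-injective (Unique.allFin⁺ n))
          fits : ∀ b → Instance.load batch (presentAt t) (λ i → idx i ℕ./ K) b ≤ 1ℝ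
          fits b = length≤K⇒sizes≤1 (filter (λ i → idx i ℕ./ K ℕ.≟ b) (presentAt t))
              (length-block≤ K idx (presentAt t) b idx!)
          minimal : ∀ k′ → Packable t k′ → k ℕ.≤ k′
          minimal k′ (b , b<k′ , cap) = ℕ.*-cancelʳ-≤ k k′ K (subst (ℕ._≤ k′ ℕ.* K) len
            (length≤bins*capacity k′ b (presentAt t) b<k′
                (λ c → sizes≤1⇒length≤K (filter (λ i → b i ℕ.≟ c) (presentAt t)) (cap c))))

      -- Active time forced by the items that stay until `T`.

      module Survivors (K : ℕ) (Kσ≡1 : fromℕ K * σ ≡ 1ℝ) (T : ℝ) (survivors : List (Fin n))
          (unique : Unique survivors)
                       (dur≡T : ∀ {i} → i ∈ survivors → dur i ≡ T) where
        open Capacity K Kσ≡1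

        Keeps : ℝ → List (Fin n) → Set
        Keeps t p = t < T → survivors ⊆ p

        delayed-keeps : ∀ ds t next p → Keeps t p → All (λ f → Keeps (time f) (present f)) (delayedFrames t next p ds)
        delayed-keeps []       t next p keeps = []
        delayed-keeps (d ∷ ds) t next p keeps with t + Delayed.wait d <? next
        ... | no  _ = []
        ... | yes _ = keeps′ ∷ delayed-keeps ds _ next p keeps′
          where
          keeps′ : Keeps (t + Delayed.wait d) p
          keeps′ lt = keeps (<-trans (x<x+y t (Delayed.wait-pos d)) lt)

        -- A departure strictly before `T` cannot be that of a survivor, since survivors end exactly
        -- at `T`.
        depart-keeps : ∀ i t p → t ≤ eventTime (depart i) → Keeps t p → Keeps (eventTime (depart i))
            (update (depart i) p)
        depart-keeps i t p t≤e keeps e<T {j} j∈ = ∈-filter⁺ (λ j → ¬? (j Fin.≟ i)) (keeps (≤-<-trans t≤e e<T) j∈) j≢i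
          where
          j≢i : j ≢ i
          j≢i refl = <-irrefl (trans (+-identityˡ (dur j)) (dur≡T j∈)) e<T

        continue-keeps : ∀ A h p t es → Linked _≤_ (t ∷ map eventTime es) → All
            (λ e → ∃[ i ] e ≡ depart i) es → Keeps t p →
          All (λ f → Keeps (time f) (present f)) (continue A h p t es)
        continue-keeps A h p t []       _           _                  keeps = keeps ∷ []
        continue-keeps A h p t (e ∷ es) (t≤e ∷ ord) ((i , refl) ∷ dep) keeps =
          keeps ∷ All.++⁺ (delayed-keeps (Reaction.later (A h)) t _ p keeps)
            (continue-keeps A _ _ _ es ord dep (depart-keeps i t p t≤e keeps))

        survivingBins : Frame → ℕ
        survivingBins f = distinct (map (bin f) survivors)

        survivingBins≤nonemptyBins : ∀ f → survivors ⊆ present f → survivingBins f ℕ.≤ nonemptyBins f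
        survivingBins≤nonemptyBins f sub = distinct-mono {map (bin f) survivors} λ z∈ →
          let i , i∈ , z≡ = ∈-map⁻ (bin f) z∈ in subst (_∈ map (bin f) (present f)) (sym z≡) (∈-map⁺ (bin f) (sub i∈))

        -- Survivors are present in both frames, so every survivor that changes its bin is recorded
        -- in `migratedItems`.
        survivingBins-migration : ∀ f g → survivors ⊆ present f → survivors ⊆ present g →
          survivingBins f ℕ.≤ survivingBins g ℕ.+ length (migratedItems f g)
        survivingBins-migration f g f⊇ g⊇ = ℕ.≤-trans (distinct-map (bin f) (bin g) survivors)
          (ℕ.+-monoʳ-≤ (survivingBins g)
              (unique-⊆⇒length-≤ (Unique.filter⁺ (λ i → ¬? (bin f i ℕ.≟ bin g i)) unique) λ i∈ →
            let i∈s , moved = ∈-filter⁻ (λ i → ¬? (bin f i ℕ.≟ bin g i)) i∈ in ∈-filter⁺ _ (g⊇ i∈s) (f⊇ i∈s , moved)))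

        -- Each migration of a survivor frees at most one bin, so at all times before T at least
        -- survivingBins f minus the number K * migrations of moved items are nonempty.
        activeTime-lower : ∀ f fs → TimeOrdered (f ∷ fs) → All (λ g → Keeps (time g) (present g)) (f ∷ fs) →
          Any (λ g → T ≤ time g) (f ∷ fs) → time f ≤ T →
          (T - time f) * fromℕ (survivingBins f) ≤ activeTime (f ∷ fs) + (T - time f) *
              (fromℕ K * migrations (f ∷ fs))
        activeTime-lower f fs ord keeps reaches (inj₂ refl) = begin
          (T - T) * fromℕ (survivingBins f) ≡⟨ trans (cong (_* fromℕ (survivingBins f)) (-‿inverseʳ T)) (zeroˡ _) ⟩
          0ℝ                                ≤⟨ 0≤+ (activeTime-nonneg (f ∷ fs) ord)
              (0≤* (x≤y⇒0≤y-x (≤-refl {T})) (0≤* (0≤fromℕ K) (migrations-nonneg (f ∷ fs)))) ⟩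
          activeTime (f ∷ fs) + (T - T) * (fromℕ K * migrations (f ∷ fs)) ∎
          where open ≤-Reasoning
        activeTime-lower f []       ord         keeps             (here T≤f)      (inj₁ f<T) = ⊥-elim (≤⇒≯ T≤f f<T)
        activeTime-lower f (g ∷ fs) (f≤g ∷ ord) (keepsF ∷ keeps) reaches (inj₁ f<T) with T ≤? time g
        -- The frame `f` alone covers the time up to `T`; no migration has to be charged.
        ... | yes T≤g = begin
          (T - time f) * fromℕ (survivingBins f)
            ≤⟨ *-monoˡ-≤ (0≤fromℕ (survivingBins f)) (+-monoˡ-≤ (- time f) T≤g) ⟩
          (time g - time f) * fromℕ (survivingBins f)
            ≤⟨ *-monoʳ-≤ (x≤y⇒0≤y-x f≤g) (fromℕ-mono-≤ (survivingBins≤nonemptyBins f (keepsF f<T))) ⟩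
          (time g - time f) * fromℕ (nonemptyBins f)
            ≤⟨ x≤x+y _ (activeTime-nonneg (g ∷ fs) ord) ⟩
          activeTime (f ∷ g ∷ fs)
            ≤⟨ x≤x+y _ (0≤* (x≤y⇒0≤y-x (<⇒≤ f<T)) (0≤* (0≤fromℕ K) (migrations-nonneg (f ∷ g ∷ fs)))) ⟩
          activeTime (f ∷ g ∷ fs) + (T - time f) * (fromℕ K * migrations (f ∷ g ∷ fs)) ∎
          where open ≤-Reasoning
        ... | no T≰g = begin
          (T - time f) * Df
            ≡⟨ cong (_* Df) ([y-x]+[z-y]≡z-x (time f) (time g) T) ⟨
          (u + v) * Df
            ≡⟨ distribʳ Df u v ⟩
          u * Df + v * Df
            ≤⟨ +-mono-≤ (*-monoʳ-≤ 0≤u (fromℕ-mono-≤ (survivingBins≤nonemptyBins f (keepsF f<T))))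
                (*-monoʳ-≤ 0≤v Df≤) ⟩
          u * Nf + v * (Dg + fromℕ K * m)
            ≡⟨ solve 5 (λ a v d k m → a :+ v :* (d :+ k :* m) := a :+ v :* d :+ v :* (k :* m)) refl
                (u * Nf) v Dg (fromℕ K) m ⟩
          u * Nf + v * Dg + v * (fromℕ K * m)
            ≤⟨ +-monoˡ-≤ (v * (fromℕ K * m))
                (+-mono-≤ (≤-refl {u * Nf})
                (activeTime-lower g fs ord keeps (Any.tail (λ T≤f → ≤⇒≯ T≤f f<T) reaches) (<⇒≤ g<T))) ⟩
          u * Nf + (A + v * (fromℕ K * M)) + v * (fromℕ K * m)
            -- So far migrations are charged only over the length `v` from `time g` to `T`. Adding
            -- the same charge over `u` gives the common factor `u + v = T - time f`.
            ≤⟨ x≤x+y _ (0≤* 0≤u (0≤* (0≤fromℕ K) (migrations-nonneg (f ∷ g ∷ fs)))) ⟩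
          u * Nf + (A + v * (fromℕ K * M)) + v * (fromℕ K * m) + u * (fromℕ K * (m + M))
            ≡⟨ solve 7 (λ n a v k M m u → n :+ (a :+ v :* (k :* M)) :+ v :* (k :* m) :+ u :*
                (k :* (m :+ M)) := n :+ a :+ (u :+ v) :* (k :* (m :+ M))) refl (u * Nf) A v
                (fromℕ K) M m u ⟩
          u * Nf + A + (u + v) * (fromℕ K * (m + M))
            ≡⟨ cong (λ z → u * Nf + A + z * (fromℕ K * (m + M))) ([y-x]+[z-y]≡z-x (time f) (time g) T) ⟩
          activeTime (f ∷ g ∷ fs) + (T - time f) * (fromℕ K * migrations (f ∷ g ∷ fs)) ∎
          where
          open ≤-Reasoning
          g<T = ≰⇒> T≰g
          u  = time g - time f
          v  = T - time g
          Df = fromℕ (survivingBins f)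
          Dg = fromℕ (survivingBins g)
          Nf = fromℕ (nonemptyBins f)
          A  = activeTime (g ∷ fs)
          M  = migrations (g ∷ fs)
          m  = sumOver (migratedItems f g) (λ _ → σ)
          0≤u = x≤y⇒0≤y-x f≤g
          0≤v = x≤y⇒0≤y-x (<⇒≤ g<T)
          Df≤ : Df ≤ Dg + fromℕ K * m
          Df≤ = begin
            Df ≤⟨ fromℕ-mono-≤ (survivingBins-migration f g (keepsF f<T) (All.head keeps g<T)) ⟩
            fromℕ (survivingBins g ℕ.+ length (migratedItems f g)) ≡⟨ fromℕ-+ (survivingBins g) _ ⟩
            Dg + fromℕ (length (migratedItems f g)) ≡⟨ cong (Dg +_) (K*sizes≡length (migratedItems f g)) ⟨
            Dg + fromℕ K * m ∎

        cost-lower : ∀ A {i₀} → i₀ ∈ survivors →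
          T * fromℕ (distinct (map (λ i → Reaction.now (A arrivedAll) (toℕ i)) survivors))
            ≤ cost A batch + T * (fromℕ K * migratedSize A batch)
        cost-lower A {i₀} i₀∈ = begin
          T * D                                                   ≡⟨ cong (_* D) T-0≡T ⟨
          (T - 0ℝ) * D                                            ≤⟨ activeTime-lower _ _ ordered keeps reaches (<⇒≤ 0<T) ⟩
          activeTime (settled A) + (T - 0ℝ) * (fromℕ K * migrations (settled A))
            ≡⟨ cong (λ x → activeTime (settled A) + x * (fromℕ K * migrations (settled A))) T-0≡T ⟩
          activeTime (settled A) + T * (fromℕ K * migrations (settled A))
            ≤⟨ +-mono-≤ (proj₁ skip) (*-monoʳ-≤ (<⇒≤ 0<T) (*-monoʳ-≤ (0≤fromℕ K) (proj₁ (proj₂ skip)))) ⟩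
          cost A batch + T * (fromℕ K * migratedSize A batch)     ∎
          where
          open ≤-Reasoning
          D    = fromℕ (distinct (map (λ i → Reaction.now (A arrivedAll) (toℕ i)) survivors))
          skip = run-settled A i₀
          0<T : 0ℝ < T
          0<T = subst (0ℝ <_) (dur≡T i₀∈) (0<dur i₀)
          T-0≡T : T - 0ℝ ≡ T
          T-0≡T = trans (sym (+-identityʳ (T - 0ℝ))) (-‿+-cancel T 0ℝ)
          ordered : TimeOrdered (settled A)
          ordered = continue-ordered A _ _ 0ℝ departures departures-ordered
          keeps : All (λ f → Keeps (time f) (present f)) (settled A)
          keeps = continue-keeps A _ _ 0ℝ departures departures-ordered departures-depart
            λ _ {i} _ → Any.reverseAcc⁺ [] (allFin n) (inj₂ (∈-allFin i))
          reaches : Any (λ f → T ≤ time f) (settled A)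
          reaches = Any.map (λ time≡ → ≤-reflexive (sym (trans time≡ (trans (+-identityˡ (dur i₀)) (dur≡T i₀∈)))))
            (continue-reaches A _ _ 0ℝ departures (∈-departures i₀))

  -- The random instances, their optimum and the cost on them.

  module Adversary (μ : ℝ) (1≤μ : 1ℝ ≤ μ) (K L G : ℕ) .{{_ : ℕ.NonZero K}} (G≡L*K : G ≡ L ℕ.* K) (g₀ : Fin G) where

    m = 2 ℕ.* K
    σ = fromℕ K ⁻¹

    Choice : Set
    Choice = Vec (Fin m) G

    1≤K : 1ℝ ≤ fromℕ K
    1≤K = subst (_≤ fromℕ K) (+-identityʳ 1ℝ) (fromℕ-mono-≤ (ℕ.>-nonZero⁻¹ K))

    0<K : 0ℝ < fromℕ K
    0<K = <-≤-trans 0<1 1≤K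

    Kσ≡1 : fromℕ K * σ ≡ 1ℝ
    Kσ≡1 = *-inverse (fromℕ K) (0<⇒≢0 0<K)

    0≤σ : 0ℝ ≤ σ
    0≤σ = <⇒≤ (0<⇒0<⁻¹ 0<K)

    σ≤1 : σ ≤ 1ℝ
    σ≤1 = *-cancelˡ-≤ (fromℕ K) 0<K (begin
      fromℕ K * σ  ≡⟨ Kσ≡1 ⟩
      1ℝ           ≤⟨ 1≤K ⟩
      fromℕ K      ≡⟨ *-identityʳ _ ⟨
      fromℕ K * 1ℝ ∎)
      where open ≤-Reasoning

    0<μ : 0ℝ < μ
    0<μ = <-≤-trans 0<1 1≤μ

    group : Fin (G ℕ.* m) → Fin G
    group = quotient {G} m

    position : Fin (G ℕ.* m) → Fin m
    position = remainder {G} m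

    module B = Batch (G ℕ.* m) σ 0≤σ σ≤1

    longIf : ∀ {P : Set} → Dec P → ℝ
    longIf (yes _) = μ
    longIf (no  _) = 1ℝ

    1≤longIf : ∀ {P : Set} (d : Dec P) → 1ℝ ≤ longIf d
    1≤longIf (yes _) = 1≤μ
    1≤longIf (no  _) = ≤-refl

    longIf≤μ : ∀ {P : Set} (d : Dec P) → longIf d ≤ μ
    longIf≤μ (yes _) = ≤-refl
    longIf≤μ (no  _) = 1≤μ

    longIf-yes : ∀ {P : Set} (d : Dec P) → P → longIf d ≡ μ
    longIf-yes (yes _) _ = refl
    longIf-yes (no ¬p) p = ⊥-elim (¬p p)

    longIf-no : ∀ {P : Set} (d : Dec P) → ¬ P → longIf d ≡ 1ℝ
    longIf-no (yes p) ¬p = ⊥-elim (¬p p)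
    longIf-no (no _)  _  = refl

    module _ (r : Choice) where

      chosen? : ∀ i → Dec (lookup r (group i) ≡ position i)
      chosen? i = lookup r (group i) Fin.≟ position i

      dur : Fin (G ℕ.* m) → ℝ
      dur i = longIf (chosen? i)

      0<dur : ∀ i → 0ℝ < dur i
      0<dur i = <-≤-trans 0<1 (1≤longIf (chosen? i))

      instanceOf : Instance
      instanceOf = B.batch dur 0<dur

      survivors : List (Fin (G ℕ.* m))
      survivors = tabulate (λ g → combine g (lookup r g))

      survivors! : Unique survivors
      survivors! = Unique.tabulate⁺ λ {g} {g′} eq → Fin.combine-injectiveˡ g _ g′ _ eq

      chosen-combine : ∀ g j → lookup r g ≡ j → lookup r (group (combine g j)) ≡ position (combine g j)
      chosen-combine g j eq = trans (cong (lookup r ∘ proj₁) (Fin.remQuot-combine g j))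
          (trans eq (sym (cong proj₂ (Fin.remQuot-combine g j))))

      chosen-combine⁻ : ∀ g j → lookup r (group (combine g j)) ≡ position (combine g j) → lookup r g ≡ j
      chosen-combine⁻ g j eq = trans (sym (cong (lookup r ∘ proj₁) (Fin.remQuot-combine g j)))
          (trans eq (cong proj₂ (Fin.remQuot-combine g j)))

      survivor⇒chosen : ∀ {i} → i ∈ survivors → lookup r (group i) ≡ position i
      survivor⇒chosen i∈ with ∈-tabulate⁻ i∈
      ... | g , refl = chosen-combine g (lookup r g) refl

      chosen⇒≡ : ∀ i → lookup r (group i) ≡ position i → combine (group i) (lookup r (group i)) ≡ i
      chosen⇒≡ i eq = trans (cong (combine (group i)) eq) (Fin.combine-remQuot {G} m i)

      chosen⇒survivor : ∀ i → lookup r (group i) ≡ position i → i ∈ survivors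
      chosen⇒survivor i eq = subst (_∈ survivors) (chosen⇒≡ i eq) (∈-tabulate⁺ (group i))

      dur≡μ : ∀ {i} → i ∈ survivors → dur i ≡ μ
      dur≡μ {i} i∈ = longIf-yes (chosen? i) (survivor⇒chosen i∈)

      -- The group `g₀` has `2 * K ≥ 2` items, so besides its survivor it contains an item of
      -- duration 1; both extremes are attained for every choice `r`.
      hasDurationRatio : Instance.HasDurationRatio instanceOf μ
      hasDurationRatio = long , short
        , (λ i → subst (dur i ≤_) (sym dur-long) (longIf≤μ (chosen? i)))
        , (λ i → subst (_≤ dur i) (sym dur-short) (1≤longIf (chosen? i)))
        , trans dur-long (trans (sym (*-identityʳ μ)) (cong (μ *_) (sym dur-short)))
        where
        long  = combine g₀ (lookup r g₀)
        other = ∃≢ (ℕ.*-monoʳ-≤ 2 (ℕ.>-nonZero⁻¹ K)) (lookup r g₀)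
        short = combine g₀ (proj₁ other)
        dur-long : dur long ≡ μ
        dur-long = dur≡μ (∈-tabulate⁺ g₀)
        dur-short : dur short ≡ 1ℝ
        dur-short = longIf-no (chosen? short) λ eq → proj₂ other (chosen-combine⁻ g₀ (proj₁ other) eq)

      open B.Capacity dur 0<dur K Kσ≡1
      open Optimum instanceOf using (IsMinBins)

      G*m≡2G*K : G ℕ.* m ≡ 2 ℕ.* G ℕ.* K
      G*m≡2G*K = NS.solve 2 (λ g k → g NS.:* (NS.con 2 NS.:* k) NS.:= NS.con 2 NS.:* g NS.:* k) refl G K
        where module NS = +-*-Solver

      totalSize≡ : Instance.totalSize instanceOf ≡ fromℕ (2 ℕ.* G)
      totalSize≡ = begin
        sumOver (allFin (G ℕ.* m)) (λ _ → σ) ≡⟨ sumOver-const (allFin (G ℕ.* m)) σ ⟩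
        fromℕ (length (allFin (G ℕ.* m))) * σ ≡⟨ cong (λ l → fromℕ l * σ)
            (trans (List.length-tabulate {n = G ℕ.* m} id) G*m≡2G*K) ⟩
        fromℕ (2 ℕ.* G ℕ.* K) * σ   ≡⟨ cong (_* σ) (fromℕ-* (2 ℕ.* G) K) ⟩
        fromℕ (2 ℕ.* G) * fromℕ K * σ ≡⟨ *-assoc _ _ _ ⟩
        fromℕ (2 ℕ.* G) * (fromℕ K * σ) ≡⟨ cong (fromℕ (2 ℕ.* G) *_) Kσ≡1 ⟩
        fromℕ (2 ℕ.* G) * 1ℝ        ≡⟨ *-identityʳ _ ⟩
        fromℕ (2 ℕ.* G)             ∎
        where open ≡-Reasoning

      none-present : ∀ t → (∀ i → ¬ (0ℝ ≤ t × t < 0ℝ + dur i)) → IsMinBins t 0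
      none-present t absent = isMinBins t 0 toℕ (λ {i} pi → ⊥-elim (absent i pi)) (λ {i} pi → ⊥-elim (absent i pi))
        (cong length (List.filter-none (present? t) {xs = allFin (G ℕ.* m)} (All.tabulate λ {i} _ → absent i)))

      all-present : ∀ t → 0ℝ ≤ t → t < 1ℝ → IsMinBins t (2 ℕ.* G)
      all-present t 0≤t t<1 = isMinBins t (2 ℕ.* G) toℕ (λ _ _ → Fin.toℕ-injective)
        (λ {i} _ → subst (toℕ i ℕ.<_) G*m≡2G*K (Fin.toℕ<n i))
        (trans (cong length (List.filter-all (present? t) {xs = allFin (G ℕ.* m)} (All.tabulate λ {i} _ → 0≤t ,
          <-≤-trans t<1 (subst (1ℝ ≤_) (sym (+-identityˡ (dur i))) (1≤longIf (chosen? i))))))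
          (trans (List.length-tabulate {n = G ℕ.* m} id) G*m≡2G*K))

      -- One item per group remains, so the group number indexes the present items injectively below
      -- `G = L * K`, and they fill `L` bins exactly.
      survivors-present : ∀ t → 1ℝ ≤ t → t < μ → IsMinBins t L
      survivors-present t 1≤t t<μ = isMinBins t L (toℕ ∘ group) inj
        (λ {i} _ → subst (toℕ (group i) ℕ.<_) G≡L*K (Fin.toℕ<n (group i)))
        (trans (ℕ.≤-antisym
            (unique-⊆⇒length-≤ (Unique.filter⁺ (present? t) (Unique.allFin⁺ (G ℕ.* m)))
              λ {i} i∈ → chosen⇒survivor i
                  (present⇒chosen (proj₂ (∈-filter⁻ (present? t) {xs = allFin (G ℕ.* m)} i∈))))
            (unique-⊆⇒length-≤ survivors! λ {i} i∈ → ∈-filter⁺ (present? t) (∈-allFin i)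
              (≤-trans (<⇒≤ 0<1) 1≤t , subst (t <_) (sym (trans (+-identityˡ (dur i)) (dur≡μ i∈))) t<μ)))
          (trans (List.length-tabulate (λ g → combine g (lookup r g))) G≡L*K))
        where
        present⇒chosen : ∀ {i} → 0ℝ ≤ t × t < 0ℝ + dur i → lookup r (group i) ≡ position i
        present⇒chosen {i} (_ , t<) with chosen? i
        ... | yes eq = eq
        ... | no  _  = ⊥-elim (≤⇒≯ 1≤t (subst (t <_) (+-identityˡ 1ℝ) t<))
        inj : ∀ {i j} → 0ℝ ≤ t × t < 0ℝ + dur i → 0ℝ ≤ t × t < 0ℝ + dur j → toℕ (group i) ≡ toℕ (group j) → i ≡ j
        inj {i} {j} pi pj eq = trans (sym (chosen⇒≡ i (present⇒chosen pi)))
          (trans (cong (λ g → combine g (lookup r g)) (Fin.toℕ-injective eq)) (chosen⇒≡ j (present⇒chosen pj)))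

      -- The decisions are arguments, so that minimality can be proved by matching on them.
      optAt : ∀ t → Dec (0ℝ ≤ t) → Dec (t < 1ℝ) → Dec (t < μ) → ℕ
      optAt t (no  _) _       _       = 0
      optAt t (yes _) (yes _) _       = 2 ℕ.* G
      optAt t (yes _) (no  _) (yes _) = L
      optAt t (yes _) (no  _) (no  _) = 0

      optAt-isMinBins : ∀ t a b c → IsMinBins t (optAt t a b c)
      optAt-isMinBins t (no 0≰t)  _         _         = none-present t λ _ (0≤t , _) → 0≰t 0≤t
      optAt-isMinBins t (yes 0≤t) (yes t<1) _         = all-present t 0≤t t<1
      optAt-isMinBins t (yes _)   (no t≮1)  (yes t<μ) = survivors-present t (≮⇒≥ t≮1) t<μ
      optAt-isMinBins t (yes _)   (no _)    (no t≮μ)  = none-present t λ i (_ , t<) →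
        t≮μ (<-≤-trans t< (subst (_≤ μ) (sym (+-identityˡ (dur i))) (longIf≤μ (chosen? i))))

      opt : ℝ → ℕ
      opt t = optAt t (0ℝ ≤? t) (t <? 1ℝ) (t <? μ)

      isOPT : IsOPT instanceOf ((1ℝ - 0ℝ) * fromℕ (2 ℕ.* G) + ((μ - 1ℝ) * fromℕ L + 0ℝ))
      isOPT = opt , (λ t → optAt-isMinBins t (0ℝ ≤? t) (t <? 1ℝ) (t <? μ))
            , step (2 ℕ.* G) (<⇒≤ 0<1) first (step L 1≤μ second (tail third))
        where
        first : ∀ t → 0ℝ ≤ t → t < 1ℝ → opt t ≡ 2 ℕ.* G
        first t 0≤t t<1 with 0ℝ ≤? t | t <? 1ℝ
        ... | yes _  | yes _  = refl
        ... | no 0≰t | _      = ⊥-elim (0≰t 0≤t)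
        ... | yes _  | no t≮1 = ⊥-elim (t≮1 t<1)
        second : ∀ t → 1ℝ ≤ t → t < μ → opt t ≡ L
        second t 1≤t t<μ with 0ℝ ≤? t | t <? 1ℝ | t <? μ
        ... | no 0≰t | _       | _      = ⊥-elim (0≰t (≤-trans (<⇒≤ 0<1) 1≤t))
        ... | yes _  | yes t<1 | _      = ⊥-elim (≤⇒≯ 1≤t t<1)
        ... | yes _  | no _    | yes _  = refl
        ... | yes _  | no _    | no t≮μ = ⊥-elim (t≮μ t<μ)
        third : ∀ t → μ ≤ t → opt t ≡ 0
        third t μ≤t with 0ℝ ≤? t | t <? 1ℝ | t <? μ
        ... | no _  | _       | _       = refl
        ... | yes _ | yes t<1 | _       = ⊥-elim (≤⇒≯ (≤-trans 1≤μ μ≤t) t<1)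
        ... | yes _ | no _    | yes t<μ = ⊥-elim (≤⇒≯ μ≤t t<μ)
        ... | yes _ | no _    | no _    = refl

    -- Until the first departure the choice r is invisible, so this does not depend on it.
    settledBin : Algorithm → Fin G → Fin m → ℕ
    settledBin A g j = Reaction.now (A B.arrivedAll) (toℕ (combine g j))

    cost≥ : ∀ A r → μ * fromℕ (distinct (picked (settledBin A) r))
                      ≤ cost A (instanceOf r) + μ * (fromℕ K * migratedSize A (instanceOf r))
    cost≥ A r = subst (λ bs → μ * fromℕ (distinct bs) ≤ cost A (instanceOf r) + μ *
        (fromℕ K * migratedSize A (instanceOf r)))
      (trans (List.map-tabulate (λ g → combine g (lookup r g)) _) (tabulate-lookup≡picked (settledBin A) r))
      (B.Survivors.cost-lower (dur r) (0<dur r) K Kσ≡1 μ (survivors r) (survivors! r) (dur≡μ r) A (∈-tabulate⁺ g₀))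

    -- Feasibility on a single instance bounds the average over all of them, because `settledBin` is
    -- the same for every choice.
    average-distinct : ∀ A r → All Execution.Frame.Feasible (Execution.run (instanceOf r) A) →
      G ℕ.* m ℕ.^ G ℕ.≤ 2 ℕ.* ∑ (choices m G) (λ r → distinct (picked (settledBin A) r))
    average-distinct A r feasible = ∑-distinct K G (settledBin A) λ x → subst (ℕ._≤ K)
      (trans (length-filter-∑ (λ i → Reaction.now (A B.arrivedAll) (toℕ i) ℕ.≟ x) (allFin (G ℕ.* m)))
             (sym (occurrences-combine G (λ i → Reaction.now (A B.arrivedAll) (toℕ i)) x)))
      (B.Capacity.settled-capacity (dur r) (0<dur r) K Kσ≡1 A (combine g₀ (lookup r g₀)) feasible x)

  -- Averaging over choices and passing to probabilities.

  module Averaging (μ : ℝ) (1≤μ : 1ℝ ≤ μ) (K L G : ℕ) .{{_ : ℕ.NonZero K}} (G≡L*K : G ≡ L ℕ.* K) (g₀ : Fin G)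
    (A : RandomizedAlgorithm) (q H : ℕ) (G≡2H : G ≡ 2 ℕ.* H) where
    open RandomizedAlgorithm A
    open Probability R
    open ProbabilitySpace space using (Ω; ℙ; Measurable)
    open ProbabilityProperties R space
    open Adversary μ 1≤μ K L G G≡L*K g₀

    hit : Ω → Choice → ℕ
    hit ω r = distinct (picked (settledBin (algorithm ω)) r)

    open module Layers r = LayerCake (cost-measurable (instanceOf r)) (<⇒≤ 0<μ) using (level)

    manyMigrated : Choice → Pred Ω 0ℓ
    manyMigrated r ω = fromℕ q < migratedSize (algorithm ω) (instanceOf r)

    -- The label nothing stands for large migration, just d for the level suc d of the cost.
    event : Choice × Maybe ℕ → Pred Ω 0ℓ
    event (r , nothing) = manyMigrated r
    event (r , just d)  = level r (suc d)

    event-measurable : ∀ x → Measurable (event x)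
    event-measurable (r , nothing) = migrated-measurable (instanceOf r) _
    event-measurable (r , just d)  = cost-measurable (instanceOf r) _

    -- When much is migrated, the cost estimate says too little; the trivial bound `hit≤G` is used
    -- there, which is why that event weighs `G`.
    weight : Choice × Maybe ℕ → ℝ
    weight (_ , nothing) = fromℕ G
    weight (_ , just _)  = 1ℝ

    labels : List (Maybe ℕ)
    labels = nothing ∷ map just (downFrom G)

    sumOver-labels : ∀ r (f : Pred Ω 0ℓ → ℝ) →
      sumOver labels (λ l → weight (r , l) * f (event (r , l)))
        ≡ fromℕ G * f (manyMigrated r) + sumOver (downFrom G) (λ d → f (level r (suc d)))
    sumOver-labels r f = cong (fromℕ G * f (manyMigrated r) +_)
      (trans (sumOver-map just (downFrom G) _) (sumOver-cong (downFrom G) λ d → *-identityˡ _))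

    -- Migrating at most `q` frees at most `K * q` bins; the extra 1 is due to levels being defined
    -- by a strict inequality.
    slack : ℝ
    slack = fromℕ (suc (K ℕ.* q))

    hit≤G : ∀ ω r → hit ω r ℕ.≤ G
    hit≤G ω r = ℕ.≤-trans (distinct≤length (picked β r)) (ℕ.≤-reflexive (length-picked β r))
      where β = settledBin (algorithm ω)

    level-reached : ∀ ω r → migratedSize (algorithm ω) (instanceOf r) ≤ fromℕ q →
      ∀ d → d ℕ.< hit ω r ℕ.∸ suc (K ℕ.* q) → level r (suc d) ω
    level-reached ω r mig≤q d d< = ≰⇒> λ cost≤ → ≤⇒≯ (begin
      μ * fromℕ (hit ω r)
        ≤⟨ cost≥ (algorithm ω) r ⟩
      cost (algorithm ω) (instanceOf r) + μ * (fromℕ K * migratedSize (algorithm ω) (instanceOf r))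
        ≤⟨ +-mono-≤ cost≤ (*-monoʳ-≤ (<⇒≤ 0<μ) (*-monoʳ-≤ (0≤fromℕ K) mig≤q)) ⟩
      μ * fromℕ (suc d) + μ * (fromℕ K * fromℕ q)
        ≡⟨ cong (λ x → μ * fromℕ (suc d) + μ * x) (fromℕ-* K q) ⟨
      μ * fromℕ (suc d) + μ * fromℕ (K ℕ.* q)
        ≡⟨ distribˡ μ _ _ ⟨
      μ * (fromℕ (suc d) + fromℕ (K ℕ.* q))
        ≡⟨ cong (μ *_) (fromℕ-+ (suc d) (K ℕ.* q)) ⟨
      μ * fromℕ (suc d ℕ.+ K ℕ.* q) ∎)
      (begin-strict
      μ * fromℕ (suc d ℕ.+ K ℕ.* q) ≡⟨ *-comm μ _ ⟩
      fromℕ (suc d ℕ.+ K ℕ.* q) * μ <⟨ *-monoˡ-< 0<μ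
          (<-≤-trans (subst (fromℕ (suc d ℕ.+ K ℕ.* q) <_) (+-comm _ 1ℝ) (x<x+y _ 0<1))
          (fromℕ-mono-≤ big)) ⟩
      fromℕ (hit ω r) * μ ≡⟨ *-comm _ μ ⟩
      μ * fromℕ (hit ω r) ∎)
      where
      open ≤-Reasoning
      big : suc (suc d ℕ.+ K ℕ.* q) ℕ.≤ hit ω r
      big = subst (ℕ._≤ hit ω r) (ℕ.+-suc (suc d) (K ℕ.* q)) (<-∸ (hit ω r) (suc (K ℕ.* q)) d<)

    -- With large migration the weight `G` covers `hit` alone. Otherwise `level-reached` turns all
    -- but `slack` of the bins into levels attained by the cost.
    hit≤ : ∀ ω r → fromℕ (hit ω r) ≤ sumOver labels (λ l → weight (r , l) * indicator (em (event (r , l) ω))) + slack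
    hit≤ ω r = subst (λ x → fromℕ (hit ω r) ≤ x + slack) (sym (sumOver-labels r (λ E → indicator (em (E ω)))))
      (bound (em (manyMigrated r ω)))
      where
      open ≤-Reasoning
      reached = sumOver (downFrom G) (λ d → indicator (em (level r (suc d) ω)))
      0≤reached : 0ℝ ≤ reached
      0≤reached = ≤sumOver-indicator G 0 (λ d → level r (suc d) ω) ℕ.z≤n (λ _ ())
      bound : (d : Dec (manyMigrated r ω)) → fromℕ (hit ω r) ≤ fromℕ G * indicator d + reached + slack
      bound (yes _) = begin
        fromℕ (hit ω r)                 ≤⟨ fromℕ-mono-≤ (hit≤G ω r) ⟩
        fromℕ G                         ≡⟨ *-identityʳ _ ⟨
        fromℕ G * 1ℝ                    ≤⟨ x≤x+y _ 0≤reached ⟩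
        fromℕ G * 1ℝ + reached          ≤⟨ x≤x+y _ (0≤fromℕ (suc (K ℕ.* q))) ⟩
        fromℕ G * 1ℝ + reached + slack  ∎
      bound (no few) = begin
        fromℕ (hit ω r)
          ≤⟨ fromℕ-mono-≤ (ℕ.m≤n+m∸n (hit ω r) (suc (K ℕ.* q))) ⟩
        fromℕ (suc (K ℕ.* q) ℕ.+ (hit ω r ℕ.∸ suc (K ℕ.* q)))
          ≡⟨ trans (fromℕ-+ (suc (K ℕ.* q)) _) (+-comm slack _) ⟩
        fromℕ (hit ω r ℕ.∸ suc (K ℕ.* q)) + slack
          ≤⟨ +-monoˡ-≤ slack (≤sumOver-indicator G (hit ω r ℕ.∸ suc (K ℕ.* q)) (λ d → level r (suc d) ω)
              (ℕ.≤-trans (ℕ.m∸n≤m (hit ω r) (suc (K ℕ.* q))) (hit≤G ω r)) (level-reached ω r (≮⇒≥ few))) ⟩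
        reached + slack
          ≡⟨ cong (_+ slack) (trans (cong (_+ reached) (zeroʳ (fromℕ G))) (+-identityˡ reached)) ⟨
        fromℕ G * 0ℝ + reached + slack ∎

    κ : ℝ
    κ = fromℕ (length (choices m G)) * (fromℕ H - slack)

    κ≤ : ∀ ω → κ ≤ sumOver (cartesianProduct (choices m G) labels) (λ x → weight x * indicator (em (event x ω)))
    κ≤ ω = subst (κ ≤_) (sym (sumOver-cartesianProduct (choices m G) labels _)) (+-cancelʳ-≤ (N * slack) (begin
      N * (fromℕ H - slack) + N * slack    ≡⟨ distribˡ N _ _ ⟨
      N * (fromℕ H - slack + slack)        ≡⟨ cong (N *_) (-‿+-cancel (fromℕ H) slack) ⟩
      N * fromℕ H                          ≡⟨ fromℕ-* (length (choices m G)) H ⟨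
      fromℕ (length (choices m G) ℕ.* H)   ≤⟨ fromℕ-mono-≤ half ⟩
      fromℕ (∑ (choices m G) (hit ω))      ≡⟨ sumOver-fromℕ (choices m G) (hit ω) ⟨
      sumOver (choices m G) (λ r → fromℕ (hit ω r)) ≤⟨ sumOver-mono (choices m G) (hit≤ ω) ⟩
      sumOver (choices m G) (λ r → W r + slack)     ≡⟨ trans (sumOver-+ (choices m G) W _)
          (cong (sumOver (choices m G) W +_) (sumOver-const (choices m G) slack)) ⟩
      sumOver (choices m G) W + N * slack           ∎))
      where
      open ≤-Reasoning
      N = fromℕ (length (choices m G))
      W = λ r → sumOver labels (λ l → weight (r , l) * indicator (em (event (r , l) ω)))
      -- Any choice would do: it only supplies an instance on which feasibility is invoked.
      r₀ : Choice
      r₀ = replicate G (Fin.fromℕ< (ℕ.≤-trans (ℕ.s≤s ℕ.z≤n) (ℕ.*-monoʳ-≤ 2 (ℕ.>-nonZero⁻¹ K))))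
      half : length (choices m G) ℕ.* H ℕ.≤ ∑ (choices m G) (hit ω)
      half = ℕ.*-cancelˡ-≤ 2 (ℕ.≤-trans (ℕ.≤-reflexive rearrange)
          (average-distinct (algorithm ω) r₀ (feasible ω (instanceOf r₀))))
        where
        rearrange : 2 ℕ.* (length (choices m G) ℕ.* H) ≡ G ℕ.* m ℕ.^ G
        rearrange = trans (cong (λ l → 2 ℕ.* (l ℕ.* H)) (length-choices m G))
          (trans (NS.solve 2 (λ h r → NS.con 2 NS.:* (r NS.:* h) NS.:= (NS.con 2 NS.:* h) NS.:* r) refl H
              (m ℕ.^ G)) (cong (ℕ._* m ℕ.^ G) (sym G≡2H)))
          where module NS = +-*-Solver

    -- `κ≤` holds for each `ω`, so `≤sumOver-ℙ` replaces indicators by probabilities; a choice that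
    -- reaches the average then fixes one deterministic instance.
    good-choice : ∃[ r ] fromℕ H - slack ≤ fromℕ G * ℙ (manyMigrated r) + sumOver (downFrom G)
        (λ d → ℙ (level r (suc d)))
    good-choice = proj₁ found , subst (fromℕ H - slack ≤_) (sumOver-labels (proj₁ found) ℙ) (proj₂ found)
      where
      V : Choice → ℝ
      V r = sumOver labels (λ l → weight (r , l) * ℙ (event (r , l)))
      nonempty : 0ℝ < fromℕ (length (choices m G))
      nonempty = <-≤-trans (0<fromℕ 0) (fromℕ-mono-≤ (subst (1 ℕ.≤_) (sym (length-choices m G))
        (ℕ.m^n>0 m {{ℕ.m*n≢0 2 K}} G)))
      found : ∃[ r ] fromℕ H - slack ≤ V r
      found = sumOver-≥⇒∃≥ (choices m G) V (fromℕ H - slack) nonempty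
        (subst (κ ≤_) (sumOver-cartesianProduct (choices m G) labels (λ x → weight x * ℙ (event x)))
          (≤sumOver-ℙ weight event event-measurable (cartesianProduct (choices m G) labels) κ κ≤))

  open RandomizedAlgorithm using (space; algorithm; cost-measurable; migrated-measurable; 𝔼[_]≤_; 𝔼[_]>_)

  -- Numerical estimates in units of `K * q`.

  module Instances (μ : ℝ) (1≤μ : 1ℝ ≤ μ) (A : RandomizedAlgorithm)
    (K q L G H c : ℕ) .{{_ : ℕ.NonZero K}} .{{_ : ℕ.NonZero q}} .{{c≢0 : ℕ.NonZero c}}
    (2μ≤K : fromℕ 2 * μ ≤ fromℕ K) (L≡24q : L ≡ 24 ℕ.* q) (G≡L*K : G ≡ L ℕ.* K)
    (H≡12Kq : H ≡ 12 ℕ.* (K ℕ.* q)) (cq≡48G : c ℕ.* q ≡ 48 ℕ.* G)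
    (sublinear : ∀ I → Instance.HasDurationRatio I μ → fromℕ q ≤ Instance.totalSize I →
      𝔼[_]≤_ A (λ ω → migratedSize (algorithm A ω) I) (fromℕ c ⁻¹ * Instance.totalSize I)) where
    open ≤-Reasoning
    private
      module NS = +-*-Solver

    G≡24Kq : G ≡ 24 ℕ.* (K ℕ.* q)
    G≡24Kq = trans G≡L*K (trans (cong (ℕ._* K) L≡24q)
      (NS.solve 2 (λ k q → NS.con 24 NS.:* q NS.:* k NS.:= NS.con 24 NS.:* (k NS.:* q)) refl K q))

    2G≡48Kq : 2 ℕ.* G ≡ 48 ℕ.* (K ℕ.* q)
    2G≡48Kq = trans (cong (2 ℕ.*_) G≡24Kq) (sym (ℕ.*-assoc 2 24 (K ℕ.* q)))

    G≡2H : G ≡ 2 ℕ.* H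
    G≡2H = trans G≡24Kq (trans (ℕ.*-assoc 2 12 (K ℕ.* q)) (cong (2 ℕ.*_) (sym H≡12Kq)))

    q≤2G : q ℕ.≤ 2 ℕ.* G
    q≤2G = subst (q ℕ.≤_) (sym 2G≡48Kq) (ℕ.≤-trans (ℕ.m≤n*m q K) (ℕ.m≤n*m (K ℕ.* q) 48))

    0<G : 0 ℕ.< G
    0<G = subst (0 ℕ.<_) (sym G≡24Kq) (ℕ.≤-trans (ℕ.>-nonZero⁻¹ q) (ℕ.≤-trans (ℕ.m≤n*m q K) (ℕ.m≤n*m (K ℕ.* q) 24)))

    0<c : 0ℝ < fromℕ c
    0<c = <-≤-trans (0<fromℕ 0) (fromℕ-mono-≤ (ℕ.>-nonZero⁻¹ c))

    g₀ : Fin G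
    g₀ = Fin.fromℕ< 0<G

    open Adversary μ 1≤μ K L G G≡L*K g₀
    open Averaging μ 1≤μ K L G G≡L*K g₀ A q H G≡2H using (good-choice; manyMigrated)
    open Probability.ProbabilitySpace (space A) using (ℙ)
    open ProbabilityProperties R (space A) using (markov; module LayerCake)

    r = proj₁ good-choice
    open LayerCake (cost-measurable A (instanceOf r)) (<⇒≤ 0<μ) using (level; layered⇒𝔼>)

    P = ℙ (manyMigrated r)
    Σℙ = sumOver (downFrom G) (λ d → ℙ (level (suc d)))
    v = (1ℝ - 0ℝ) * fromℕ (2 ℕ.* G) + ((μ - 1ℝ) * fromℕ L + 0ℝ)

    q*P≤ : fromℕ q * P ≤ fromℕ c ⁻¹ * fromℕ (2 ℕ.* G)
    q*P≤ = subst (λ x → fromℕ q * P ≤ fromℕ c ⁻¹ * x) (totalSize≡ r)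
      (markov (migrated-measurable A (instanceOf r)) (0≤fromℕ q)
        (sublinear (instanceOf r) (hasDurationRatio r) (begin
          fromℕ q                           ≤⟨ fromℕ-mono-≤ q≤2G ⟩
          fromℕ (2 ℕ.* G)                   ≡⟨ totalSize≡ r ⟨
          Instance.totalSize (instanceOf r) ∎)))

    -- The expected migration is at most `2G/c = q/24`, as `c * q = 48 * G`. Markov at threshold `q`
    -- gives `P ≤ 1/24`, and `G/24` is `K * q`.
    G*P≤Kq : fromℕ G * P ≤ fromℕ (K ℕ.* q)
    G*P≤Kq = *-cancelˡ-≤ (fromℕ 48) (0<fromℕ 47) (begin
      fromℕ 48 * (fromℕ G * P)                   ≡⟨ *-assoc _ _ _ ⟨
      fromℕ 48 * fromℕ G * P                     ≡⟨ cong (_* P) (fromℕ-* 48 G) ⟨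
      fromℕ (48 ℕ.* G) * P                       ≡⟨ cong (λ x → fromℕ x * P) cq≡48G ⟨
      fromℕ (c ℕ.* q) * P                        ≡⟨ cong (_* P) (fromℕ-* c q) ⟩
      fromℕ c * fromℕ q * P                      ≡⟨ *-assoc _ _ _ ⟩
      fromℕ c * (fromℕ q * P)                    ≤⟨ *-monoʳ-≤ (<⇒≤ 0<c) q*P≤ ⟩
      fromℕ c * (fromℕ c ⁻¹ * fromℕ (2 ℕ.* G))   ≡⟨ *-assoc _ _ _ ⟨
      fromℕ c * fromℕ c ⁻¹ * fromℕ (2 ℕ.* G)     ≡⟨ cong (_* fromℕ (2 ℕ.* G)) (*-inverse _ (0<⇒≢0 0<c)) ⟩
      1ℝ * fromℕ (2 ℕ.* G)                       ≡⟨ *-identityˡ _ ⟩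
      fromℕ (2 ℕ.* G)                            ≡⟨ cong fromℕ 2G≡48Kq ⟩
      fromℕ (48 ℕ.* (K ℕ.* q))                   ≡⟨ fromℕ-* 48 (K ℕ.* q) ⟩
      fromℕ 48 * fromℕ (K ℕ.* q)                 ∎)

    -- Of the `H = 12 * (K * q)` bins, one unit goes to `slack` and one to large migration; the 1 on
    -- the right is the remainder of `slack`.
    10Kq≤1+Σℙ : fromℕ (10 ℕ.* (K ℕ.* q)) ≤ Σℙ + 1ℝ
    10Kq≤1+Σℙ = +-cancelʳ-≤ (fromℕ (K ℕ.* q) + fromℕ (K ℕ.* q)) (begin
      fromℕ (10 ℕ.* (K ℕ.* q)) + (fromℕ (K ℕ.* q) + fromℕ (K ℕ.* q))
        ≡⟨ trans (cong (fromℕ (10 ℕ.* (K ℕ.* q)) +_) (sym (fromℕ-+ (K ℕ.* q) (K ℕ.* q))))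
            (sym (fromℕ-+ (10 ℕ.* (K ℕ.* q)) _)) ⟩
      fromℕ (10 ℕ.* (K ℕ.* q) ℕ.+ (K ℕ.* q ℕ.+ K ℕ.* q))
        ≡⟨ cong fromℕ (trans (NS.solve 1
            (λ x → NS.con 10 NS.:* x NS.:+ (x NS.:+ x) NS.:= NS.con 12 NS.:* x) refl (K ℕ.* q))
            (sym H≡12Kq)) ⟩
      fromℕ H
        ≡⟨ -‿+-cancel (fromℕ H) (fromℕ (suc (K ℕ.* q))) ⟨
      fromℕ H - fromℕ (suc (K ℕ.* q)) + fromℕ (suc (K ℕ.* q))
        ≤⟨ +-monoˡ-≤ _ (proj₂ good-choice) ⟩
      fromℕ G * P + Σℙ + (1ℝ + fromℕ (K ℕ.* q))
        ≤⟨ +-monoˡ-≤ _ (+-monoˡ-≤ Σℙ G*P≤Kq) ⟩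
      fromℕ (K ℕ.* q) + Σℙ + (1ℝ + fromℕ (K ℕ.* q))
        ≡⟨ solve 2 (λ x s → x :+ s :+ (con 1 :+ x) := s :+ con 1 :+ (x :+ x)) refl (fromℕ (K ℕ.* q)) Σℙ ⟩
      Σℙ + 1ℝ + (fromℕ (K ℕ.* q) + fromℕ (K ℕ.* q)) ∎)

    -- Adding `L` completes `(μ - 1) * L` to `μ * L`, which is at most `12 * (K * q)` by `2μ ≤ K`;
    -- the interval [0,1) contributes the other 48 units.
    v+24q≤60Kq : v + fromℕ L ≤ fromℕ (60 ℕ.* (K ℕ.* q))
    v+24q≤60Kq = begin
      v + fromℕ L
        ≡⟨ cong (λ x → x * fromℕ (2 ℕ.* G) + ((μ - 1ℝ) * fromℕ L + 0ℝ) + fromℕ L)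
            (trans (sym (+-identityʳ (1ℝ - 0ℝ))) (-‿+-cancel 1ℝ 0ℝ)) ⟩
      1ℝ * fromℕ (2 ℕ.* G) + ((μ - 1ℝ) * fromℕ L + 0ℝ) + fromℕ L
        ≡⟨ solve 3 (λ g d l → con 1 :* g :+ (d :* l :+ con 0) :+ l := g :+ (d :+ con 1) :* l) refl
            (fromℕ (2 ℕ.* G)) (μ - 1ℝ) (fromℕ L) ⟩
      fromℕ (2 ℕ.* G) + (μ - 1ℝ + 1ℝ) * fromℕ L
        ≡⟨ cong (λ x → fromℕ (2 ℕ.* G) + x * fromℕ L) (-‿+-cancel μ 1ℝ) ⟩
      fromℕ (2 ℕ.* G) + μ * fromℕ L
        ≡⟨ cong (λ x → fromℕ (2 ℕ.* G) + μ * x)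
            (trans (cong fromℕ (trans L≡24q (ℕ.*-assoc 2 12 q))) (fromℕ-* 2 (12 ℕ.* q))) ⟩
      fromℕ (2 ℕ.* G) + μ * (fromℕ 2 * fromℕ (12 ℕ.* q))
        ≡⟨ cong (fromℕ (2 ℕ.* G) +_) (trans (sym (*-assoc μ _ _)) (cong (_* fromℕ (12 ℕ.* q)) (*-comm μ (fromℕ 2)))) ⟩
      fromℕ (2 ℕ.* G) + fromℕ 2 * μ * fromℕ (12 ℕ.* q)
        ≤⟨ +-mono-≤ (≤-refl {fromℕ (2 ℕ.* G)}) (*-monoˡ-≤ (0≤fromℕ (12 ℕ.* q)) 2μ≤K) ⟩
      fromℕ (2 ℕ.* G) + fromℕ K * fromℕ (12 ℕ.* q)
        ≡⟨ trans (cong (fromℕ (2 ℕ.* G) +_) (sym (fromℕ-* K (12 ℕ.* q))))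
            (sym (fromℕ-+ (2 ℕ.* G) (K ℕ.* (12 ℕ.* q)))) ⟩
      fromℕ (2 ℕ.* G ℕ.+ K ℕ.* (12 ℕ.* q))
        ≡⟨ cong fromℕ (trans (cong (ℕ._+ K ℕ.* (12 ℕ.* q)) 2G≡48Kq)
            (NS.solve 2 (λ k q → NS.con 48 NS.:* (k NS.:* q) NS.:+ k NS.:*
            (NS.con 12 NS.:* q) NS.:= NS.con 60 NS.:* (k NS.:* q)) refl K q)) ⟩
      fromℕ (60 ℕ.* (K ℕ.* q)) ∎

    6≤L : 6 ℕ.≤ L
    6≤L = subst (6 ℕ.≤_) (sym L≡24q) (ℕ.≤-trans (ℕ.m≤m+n 6 18) (ℕ.m≤m*n 24 q))

    -- The surplus `L ≥ 6` of the previous estimate absorbs six times the rounding loss of 1, so the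
    -- factor is exactly 6.
    v≤6Σℙ : v ≤ fromℕ 6 * Σℙ
    v≤6Σℙ = +-cancelʳ-≤ (fromℕ 6) (begin
      v + fromℕ 6                          ≤⟨ +-mono-≤ (≤-refl {v}) (fromℕ-mono-≤ 6≤L) ⟩
      v + fromℕ L                          ≤⟨ v+24q≤60Kq ⟩
      fromℕ (60 ℕ.* (K ℕ.* q))             ≡⟨ cong fromℕ (ℕ.*-assoc 6 10 (K ℕ.* q)) ⟩
      fromℕ (6 ℕ.* (10 ℕ.* (K ℕ.* q)))     ≡⟨ fromℕ-* 6 (10 ℕ.* (K ℕ.* q)) ⟩
      fromℕ 6 * fromℕ (10 ℕ.* (K ℕ.* q))   ≤⟨ *-monoʳ-≤ (0≤fromℕ 6) 10Kq≤1+Σℙ ⟩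
      fromℕ 6 * (Σℙ + 1ℝ)                  ≡⟨ trans (distribˡ (fromℕ 6) Σℙ 1ℝ)
          (cong (fromℕ 6 * Σℙ +_) (*-identityʳ (fromℕ 6))) ⟩
      fromℕ 6 * Σℙ + fromℕ 6               ∎)

    -- Needed to carry the strict inequality `β < μ / 6` over to the costs.
    0<v : 0ℝ < v
    0<v = begin-strict
      0ℝ                                                   <⟨ *-pos _ _
          (subst (0ℝ <_) (trans (sym (-‿+-cancel 1ℝ 0ℝ)) (+-identityʳ (1ℝ - 0ℝ))) 0<1)
          (<-≤-trans (0<fromℕ 0) (fromℕ-mono-≤ (ℕ.≤-trans (ℕ.>-nonZero⁻¹ q) q≤2G))) ⟩
      (1ℝ - 0ℝ) * fromℕ (2 ℕ.* G)                          ≤⟨ x≤x+y _ (0≤+ (0≤* (x≤y⇒0≤y-x 1≤μ) (0≤fromℕ L)) ≤-refl) ⟩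
      v                                                    ∎

    lowerBound : ∀ β → β < μ / fromℕ 6 → ∃[ I ] Instance.HasDurationRatio I μ
      × ∃[ w ] IsOPT I w × 𝔼[_]>_ A (λ ω → cost (algorithm A ω) I) (β * w)
    lowerBound β β<μ/6 = instanceOf r , hasDurationRatio r , v , isOPT r , layered⇒𝔼> G (begin-strict
      β * v                            <⟨ *-monoˡ-< 0<v β<μ/6 ⟩
      μ * fromℕ 6 ⁻¹ * v               ≤⟨ *-monoʳ-≤ (0≤* (<⇒≤ 0<μ) (<⇒≤ (0<⇒0<⁻¹ (0<fromℕ 5)))) v≤6Σℙ ⟩
      μ * fromℕ 6 ⁻¹ * (fromℕ 6 * Σℙ)  ≡⟨ solve 4
          (λ m i s x → m :* i :* (s :* x) := m :* ((s :* i) :* x)) refl μ (fromℕ 6 ⁻¹) (fromℕ 6) Σℙ ⟩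
      μ * (fromℕ 6 * fromℕ 6 ⁻¹ * Σℙ)  ≡⟨ cong (λ x → μ * (x * Σℙ)) (*-inverse _ (0<⇒≢0 (0<fromℕ 5))) ⟩
      μ * (1ℝ * Σℙ)                    ≡⟨ cong (μ *_) (*-identityˡ Σℙ) ⟩
      μ * Σℙ                           ∎)

theorem21 : (R : CompleteOrderedField) →
    let open CompleteOrderedField R
        open DynamicBinPacking R
        open RandomizedAlgorithm
    in (μ : ℝ) → 1ℝ ≤ μ →
       (A : RandomizedAlgorithm) → SublinearMigration A μ →
       CompetitiveRatioAtLeast A μ (μ / fromℕ 6)
theorem21 R μ 1≤μ A sublinear = choose (archimedean (fromℕ 2 * μ))
  where
  open CompleteOrderedField R
  open OrderedFieldProperties R
  open DynamicBinPacking R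
  open RandomizedAlgorithm A
  module NS = +-*-Solver

  -- The rate is the inverse of `c = 48 * (24 * K)`, chosen so that `c * q = 48 * G`; it contains no
  -- `q` and can thus be fixed before `q`.
  withParameters : ∀ K q .{{_ : ℕ.NonZero K}} .{{_ : ℕ.NonZero q}} → fromℕ 2 * μ ≤ fromℕ K →
    (∀ I → Instance.HasDurationRatio I μ → fromℕ q ≤ Instance.totalSize I →
      𝔼[ (λ ω → migratedSize (algorithm ω) I) ]≤ (fromℕ (48 ℕ.* (24 ℕ.* K)) ⁻¹ * Instance.totalSize I)) →
    CompetitiveRatioAtLeast μ (μ / fromℕ 6)
  withParameters K q 2μ≤K few = LowerBound.Instances.lowerBound R μ 1≤μ A K q (24 ℕ.* q) (24 ℕ.* q ℕ.* K)
      (12 ℕ.* (K ℕ.* q)) (48 ℕ.* (24 ℕ.* K))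
    {{c≢0 = ℕ.m*n≢0 48 (24 ℕ.* K) {{_}} {{ℕ.m*n≢0 24 K}}}}
    2μ≤K refl refl refl
    (NS.solve 2 (λ k q → NS.con 48 NS.:* (NS.con 24 NS.:* k) NS.:* q NS.:= NS.con 48 NS.:*
        (NS.con 24 NS.:* q NS.:* k)) refl K q)
    few

  0<c : ∀ K .{{_ : ℕ.NonZero K}} → 0ℝ < fromℕ (48 ℕ.* (24 ℕ.* K))
  0<c K = <-≤-trans (0<fromℕ 0)
      (fromℕ-mono-≤ (ℕ.≤-trans (ℕ.>-nonZero⁻¹ K) (ℕ.≤-trans (ℕ.m≤n*m K 24) (ℕ.m≤n*m (24 ℕ.* K) 48))))

  choose : ∃[ k ] fromℕ 2 * μ ≤ fromℕ k → CompetitiveRatioAtLeast μ (μ / fromℕ 6)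
  choose (k , 2μ≤k) = choose′ (sublinear (fromℕ (48 ℕ.* (24 ℕ.* K)) ⁻¹) (0<⇒0<⁻¹ (0<c K)))
    where
    -- The successor keeps `2μ ≤ K` and makes `K` nonzero also for the type checker.
    K = suc k
    2μ≤K = ≤-trans 2μ≤k (fromℕ-mono-≤ (ℕ.n≤1+n k))
    choose′ : ∃[ S ] (∀ I → Instance.HasDurationRatio I μ → S ≤ Instance.totalSize I →
      𝔼[ (λ ω → migratedSize (algorithm ω) I) ]≤
          (fromℕ (48 ℕ.* (24 ℕ.* K)) ⁻¹ * Instance.totalSize I)) → CompetitiveRatioAtLeast μ (μ / fromℕ 6)
    -- `q` is a nonzero natural beyond `S`; the total size `2 * G` exceeds `q`, so the migration
    -- bound applies to the instances built from it.
    choose′ (S , few) = withParameters K (suc (proj₁ S≤)) 2μ≤K λ I ratio q≤ →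
      few I ratio (≤-trans (proj₂ S≤) (≤-trans (fromℕ-mono-≤ (ℕ.n≤1+n (proj₁ S≤))) q≤))
      where S≤ = archimedean S
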